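{- Let $n\ge 1$ and consider the operators on the algebra $\Lambda_n$ of symmetric polynomials in $x_1,\dots,x_n$ over $\mathbb{Q}$ $$D_+=\sum_{i=1}^n x_i^2\frac{\partial}{\partial x_i},\qquad D_0=2\sum_{i=1}^n x_i\frac{\partial}{\partial x_i},\qquad D_-=-\sum_{i=1}^n\frac{\partial}{\partial x_i}.$$ For every partition $\lambda\in\mathcal{Y}_n$, the Schur polynomial $\boldsymbol{s}_\lambda=\boldsymbol{s}_\lambda(x_1,\dots,x_n)$ satisfies $$\text{(i)}\quad D_-(\boldsymbol{s}_\lambda)=-\sum_{\mu=\lambda-\square\in\mathcal{Y}_n}(n+c(\square))\,\boldsymbol{s}_\mu,$$ $$\text{(ii)}\quad D_0(\boldsymbol{s}_\lambda)=2|\lambda|\,\boldsymbol{s}_\lambda,$$ $$\text{(iii)}\quad D_+(\boldsymbol{s}_\lambda)=\sum_{\mu=\lambda+\square\in\mathcal{Y}_n}c(\square)\,\boldsymbol{s}_\mu .$$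
   Context: $\mathcal{Y}_n$ is the set of partitions $\lambda=(\lambda_1\ge\cdots\ge\lambda_n\ge0)$ with at most $n$ nonzero parts, identified with Young diagrams with at most $n$ rows; $|\lambda|=\sum_i\lambda_i$. The Schur polynomial is $\boldsymbol{s}_\lambda=a_{\lambda+\delta}/a_\delta$, where $\delta=(n-1,n-2,\dots,1,0)$ and $a_\mu=\det(x_i^{\mu_j})_{1\le i,j\le n}$. The content of a cell $\square=(i,j)$ (row $i$, column $j$) is $c(\square)=j-i$. The sum over $\mu=\lambda-\square\in\mathcal{Y}_n$ (respectively $\mu=\lambda+\square\in\mathcal{Y}_n$) runs over all $\mu\in\mathcal{Y}_n$ whose Young diagram is obtained from that of $\lambda$ by removing (respectively adding) exactly one cell $\square$. -}

module Defs where

open import Algebra.Bundles using (CommutativeRing; RawRing)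
import Algebra.Definitions.RawMagma as RawMagmaDefinitions
import Algebra.Morphism.RingMonomorphism as RingMonomorphism
open import Algebra.Morphism.Structures using (IsRingMonomorphism)
import Algebra.Properties.CommutativeMonoid.Sum as MonoidSum
import Algebra.Properties.Ring as RingProperties
import Algebra.Properties.Semiring.Divisibility as Divisibility
import Algebra.Properties.Semiring.Exp as Exp
import Algebra.Properties.Semiring.Sum as SemiringSum
import Algebra.Solver.Ring.NaturalCoefficients.Default as Solver
open import Algebra.Structures.Biased using (isCommutativeMonoidˡ; isCommutativeSemiringˡ)
open import Data.Bool.Base using (if_then_else_)
open import Data.Empty using (⊥-elim)
open import Data.Fin.Base as Fin using (Fin; zero; suc; toℕ; punchIn; punchOut; inject₁; fromℕ)
open import Data.Fin.Permutation using (Permutation′; _⟨$⟩ʳ_; _⟨$⟩ˡ_; inverseˡ; transpose)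
open import Data.Fin.Permutation.Transposition.List using (decompose; eval; eval-decompose)
open import Data.Fin.Properties as Fin using (punchIn-punchOut; toℕ-fromℕ)
open import Data.Integer.Base as ℤ using (ℤ)
open import Data.List.Base using (List; []; _∷_; length; map)
open import Data.List.Properties using (length-map)
open import Data.Nat.Base as ℕ using (ℕ; zero; suc; _∸_; _≤_; z≤n; s≤s)
import Data.Nat.Properties as ℕ
open import Data.Product.Base using (∃₂; _×_; _,_; proj₁; proj₂)
open import Data.Rational.Base as ℚ using (ℚ; 0ℚ; 1ℚ)
open import Data.Rational.Literals using (fromℤ)
open import Data.Sum.Base using (_⊎_; inj₁; inj₂)
open import Data.Vec.Functional using (updateAt)
open import Data.Vec.Functional.Properties using (updateAt-updates; updateAt-minimal)
open import Function.Base using (_∘_; id; const)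
open import Function.Bundles using (_⇔_; mk⇔; module Equivalence)
open import Level using (_⊔_)
open import Relation.Binary.PropositionalEquality as ≡ using (_≡_; _≢_; _≗_)
open import Relation.Binary.Structures using (IsEquivalence)
open import Relation.Nullary.Decidable
  using (Dec; yes; no; does; dec-true; dec-false; _×-dec_; _→-dec_; map′)
open import Relation.Nullary.Negation using (¬_; contradiction)

module Determinant {c ℓ} (R : CommutativeRing c ℓ) where
  open CommutativeRing R hiding (zero)
  open RingProperties ring using (-1*x≈-x)
  open MonoidSum +-commutativeMonoid using (sum; sum-cong-≋; ∑-distrib-+)
  open MonoidSum *-commutativeMonoid using () renaming (sum to product)
  open SemiringSum semiring using (*-distribˡ-sum)
  open Divisibility semiring using (_∣_; _,_)
  open Exp semiring using (_^_)

  Matrix : ℕ → Set c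
  Matrix n = Fin n → Fin n → Carrier

  opaque
    alternatingSum : ∀ {n} → (Fin n → Carrier) → Carrier
    alternatingSum f = sum λ j → (- 1#) ^ toℕ j * f j

  det : ∀ {n} → Matrix n → Carrier
  det {zero}  M = 1#
  det {suc n} M = alternatingSum λ j → M zero j * det λ i k → M (suc i) (punchIn j k)

  alternant : ∀ {n} → (Fin n → Carrier) → (Fin n → ℕ) → Carrier
  alternant x μ = det λ i j → x i ^ μ j

  staircase : ∀ {n} → Fin n → ℕ
  staircase {n} j = n ∸ suc (toℕ j)

  private
    open Solver commutativeSemiring using (solve; _:+_; _:*_; _:=_; con)
    open import Relation.Binary.Reasoning.Setoid setoid

    s : Carrier
    s = - 1#

    1+s : 1# + s ≈ 0#
    1+s = -‿inverseʳ 1#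

    s*s : s * s ≈ 1#
    s*s = begin
      s * s                        ≈⟨ +-identityʳ _ ⟨
      s * s + 0#                   ≈⟨ +-congˡ 1+s ⟨
      s * s + (1# + s)             ≈⟨ solve 1 (λ a → a :* a :+ (con 1 :+ a) := a :* (con 1 :+ a) :+ con 1) refl s ⟩
      s * (1# + s) + 1#            ≈⟨ +-congʳ (trans (*-congˡ 1+s) (zeroʳ s)) ⟩
      0# + 1#                      ≈⟨ +-identityˡ 1# ⟩
      1#                           ∎

  opaque
    unfolding alternatingSum

    alt-cong : ∀ {n} {f g : Fin n → Carrier} → (∀ j → f j ≈ g j) → alternatingSum f ≈ alternatingSum g
    alt-cong f≈g = sum-cong-≋ λ j → *-congˡ (f≈g j)

    alt-suc : ∀ {n} (f : Fin (suc n) → Carrier) →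
              alternatingSum f ≈ f zero + s * alternatingSum (f ∘ suc)
    alt-suc f = +-cong (*-identityˡ _)
      (trans (sum-cong-≋ {_} {λ j → s ^ suc (toℕ j) * f (suc j)} λ j → *-assoc s _ _) (sym (*-distribˡ-sum s (λ j → s ^ toℕ j * f (suc j)))))

    alt-linear : ∀ {n} a (f g : Fin n → Carrier) →
                 alternatingSum (λ j → f j + a * g j) ≈ alternatingSum f + a * alternatingSum g
    alt-linear a f g = begin
      sum (λ j → s ^ toℕ j * (f j + a * g j))
        ≈⟨ sum-cong-≋ (λ j → solve 4 (λ p b x y → p :* (x :+ b :* y) := p :* x :+ b :* (p :* y)) refl (s ^ toℕ j) a (f j) (g j)) ⟩
      sum (λ j → s ^ toℕ j * f j + a * (s ^ toℕ j * g j))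
        ≈⟨ ∑-distrib-+ (λ j → s ^ toℕ j * f j) (λ j → a * (s ^ toℕ j * g j)) ⟩
      alternatingSum f + sum (λ j → a * (s ^ toℕ j * g j))
        ≈⟨ +-congˡ (*-distribˡ-sum a (λ j → s ^ toℕ j * g j)) ⟨
      alternatingSum f + a * alternatingSum g ∎

    alt-scale : ∀ {n} a (f : Fin n → Carrier) → alternatingSum (λ j → a * f j) ≈ a * alternatingSum f
    alt-scale a f = trans
      (sum-cong-≋ λ j → solve 3 (λ p b x → p :* (b :* x) := b :* (p :* x)) refl (s ^ toℕ j) a (f j))
      (sym (*-distribˡ-sum a (λ j → s ^ toℕ j * f j)))

    alt-empty : ∀ (f : Fin 0 → Carrier) → alternatingSum f ≈ 0#
    alt-empty f = refl

  private
    alt-zero : ∀ {n} {f : Fin n → Carrier} → (∀ j → f j ≈ 0#) → alternatingSum f ≈ 0#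
    alt-zero {f = f} f≈0 = begin
      alternatingSum f                ≈⟨ alt-cong (λ j → trans (f≈0 j) (sym (zeroˡ _))) ⟩
      alternatingSum (λ j → 0# * f j) ≈⟨ alt-scale 0# f ⟩
      0# * alternatingSum f           ≈⟨ zeroˡ _ ⟩
      0#                              ∎

    alt-last : ∀ n (f : Fin (suc n) → Carrier) → (∀ j → f (inject₁ j) ≈ 0#) →
               alternatingSum f ≈ s ^ n * f (fromℕ n)
    alt-last zero    f f≈0 = trans (trans (alt-suc f) (+-cong (sym (*-identityˡ _)) (trans (*-congˡ (alt-empty _)) (zeroʳ s)))) (+-identityʳ _)
    alt-last (suc n) f f≈0 = begin
      alternatingSum f                             ≈⟨ alt-suc f ⟩
      f zero + s * alternatingSum (f ∘ suc)        ≈⟨ +-cong (f≈0 zero) (*-congˡ (alt-last n (f ∘ suc) (f≈0 ∘ suc))) ⟩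
      0# + s * (s ^ n * f (fromℕ (suc n)))         ≈⟨ +-identityˡ _ ⟩
      s * (s ^ n * f (fromℕ (suc n)))              ≈⟨ *-assoc _ _ _ ⟨
      s ^ suc n * f (fromℕ (suc n))                ∎

  det-cong : ∀ {n} {A B : Matrix n} → (∀ i j → A i j ≈ B i j) → det A ≈ det B
  det-cong {zero}  A≈B = refl
  det-cong {suc n} A≈B = alt-cong λ j → *-cong (A≈B zero j) (det-cong λ i k → A≈B (suc i) (punchIn j k))

  det-linear : ∀ {n} (r : Fin n) {A B C : Matrix n} a →
               (∀ i → i ≢ r → ∀ j → A i j ≈ C i j) →
               (∀ i → i ≢ r → ∀ j → B i j ≈ C i j) →
               (∀ j → C r j ≈ A r j + a * B r j) →
               det C ≈ det A + a * det B
  det-linear {suc n} zero {A} {B} {C} a A≈C B≈C C≈A+aB = trans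
    (alt-cong λ j → begin
      C zero j * m C j                            ≈⟨ *-congʳ (C≈A+aB j) ⟩
      (A zero j + a * B zero j) * m C j           ≈⟨ solve 4 (λ p b q t → (p :+ b :* q) :* t := p :* t :+ b :* (q :* t)) refl (A zero j) a (B zero j) (m C j) ⟩
      A zero j * m C j + a * (B zero j * m C j)   ≈⟨ +-cong (*-congˡ (minors A A≈C j)) (*-congˡ (*-congˡ (minors B B≈C j))) ⟩
      A zero j * m A j + a * (B zero j * m B j)   ∎)
    (alt-linear a _ _)
    where
    m : Matrix (suc n) → Fin (suc n) → Carrier
    m M j = det λ i k → M (suc i) (punchIn j k)
    minors : ∀ X → (∀ i → i ≢ zero → ∀ j → X i j ≈ C i j) → ∀ j → m C j ≈ m X j
    minors X X≈C j = det-cong λ i k → sym (X≈C (suc i) (λ ()) (punchIn j k))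
  det-linear {suc n} (suc r) {A} {B} {C} a A≈C B≈C C≈A+aB = trans
    (alt-cong λ j → begin
      C zero j * m C j                            ≈⟨ *-congˡ (det-linear r a (λ i i≢r k → A≈C (suc i) (i≢r ∘ Fin.suc-injective) (punchIn j k)) (λ i i≢r k → B≈C (suc i) (i≢r ∘ Fin.suc-injective) (punchIn j k)) (λ k → C≈A+aB (punchIn j k))) ⟩
      C zero j * (m A j + a * m B j)              ≈⟨ solve 4 (λ p b q t → p :* (q :+ b :* t) := p :* q :+ b :* (p :* t)) refl (C zero j) a (m A j) (m B j) ⟩
      C zero j * m A j + a * (C zero j * m B j)   ≈⟨ +-cong (*-congʳ (sym (A≈C zero (λ ()) j))) (*-congˡ (*-congʳ (sym (B≈C zero (λ ()) j)))) ⟩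
      A zero j * m A j + a * (B zero j * m B j)   ∎)
    (alt-linear a _ _)
    where
    m : Matrix (suc n) → Fin (suc n) → Carrier
    m M j = det λ i k → M (suc i) (punchIn j k)

  det-scale : ∀ {n} (t : Fin n → Carrier) (M : Matrix n) → det (λ i j → t i * M i j) ≈ product t * det M
  det-scale {zero}  t M = sym (*-identityˡ _)
  det-scale {suc n} t M = trans
    (alt-cong λ j → begin
      t zero * M zero j * det (λ i k → t (suc i) * M (suc i) (punchIn j k))
        ≈⟨ *-congˡ (det-scale (t ∘ suc) (λ i k → M (suc i) (punchIn j k))) ⟩
      t zero * M zero j * (product (t ∘ suc) * det (λ i k → M (suc i) (punchIn j k)))
        ≈⟨ solve 4 (λ p q u v → p :* q :* (u :* v) := p :* u :* (q :* v)) refl (t zero) (M zero j) (product (t ∘ suc)) (det (λ i k → M (suc i) (punchIn j k))) ⟩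
      t zero * product (t ∘ suc) * (M zero j * det (λ i k → M (suc i) (punchIn j k))) ∎)
    (alt-scale _ _)

  private
    punchIn-punchIn : ∀ {n} {j j′ : Fin (suc (suc n))} {k k′ : Fin (suc n)} →
                      punchIn j k ≡ j′ → punchIn j′ k′ ≡ j →
                      ∀ c → punchIn j (punchIn k c) ≡ punchIn j′ (punchIn k′ c)
    punchIn-punchIn {j = zero}  {k = k}     {zero}   ≡.refl q c = ≡.refl
    punchIn-punchIn {j = suc j} {k = zero}  {k′}     ≡.refl ≡.refl c = ≡.refl
    punchIn-punchIn {j = suc j} {k = suc k} {suc k′} ≡.refl q zero    = ≡.refl
    punchIn-punchIn {suc n} {j = suc j} {k = suc k} {suc k′} ≡.refl q (suc c) =
      ≡.cong suc (punchIn-punchIn {k = k} {k′} ≡.refl (Fin.suc-injective q) c)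

    double-expansion : ∀ m (u : Fin (suc m) → Carrier) (N : Fin (suc m) → Fin m → Carrier) →
      (∀ {j k j′ k′} → punchIn j k ≡ j′ → punchIn j′ k′ ≡ j → N j k ≈ N j′ k′) →
      alternatingSum (λ j → u j * alternatingSum (λ k → u (punchIn j k) * N j k)) ≈ 0#
    double-expansion zero    u N sym-N = alt-zero λ j → trans (*-congˡ (alt-empty _)) (zeroʳ _)
    double-expansion (suc m) u N sym-N = begin
      alternatingSum (λ j → u j * alternatingSum (λ k → u (punchIn j k) * N j k))
        ≈⟨ alt-suc _ ⟩
      u zero * A + s * alternatingSum (λ j → u (suc j) * alternatingSum (λ k → u (punchIn (suc j) k) * N (suc j) k))
        ≈⟨ +-congˡ (*-congˡ (alt-cong λ j → trans (*-congˡ (alt-suc _)) (trans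
             (*-congˡ (+-congʳ (*-congˡ (sym-N {suc j} {zero} {zero} {j} ≡.refl ≡.refl))))
             (solve 5 (λ a b n t x → a :* (b :* n :+ t :* x) := b :* (a :* n) :+ t :* (a :* x)) refl (u (suc j)) (u zero) (N zero j) s (B j))))) ⟩
      u zero * A + s * alternatingSum (λ j → u zero * (u (suc j) * N zero j) + s * (u (suc j) * B j))
        ≈⟨ +-congˡ (*-congˡ (trans (alt-linear s _ _) (+-cong (alt-scale (u zero) _) (*-congˡ
             (double-expansion m (u ∘ suc) (λ j k → N (suc j) (suc k))
               (λ p q → sym-N (≡.cong suc p) (≡.cong suc q))))))) ⟩
      u zero * A + s * (u zero * A + s * 0#)
        ≈⟨ solve 2 (λ p t → p :+ t :* (p :+ t :* con 0) := (con 1 :+ t) :* p) refl (u zero * A) s ⟩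
      (1# + s) * (u zero * A)  ≈⟨ trans (*-congʳ 1+s) (zeroˡ _) ⟩
      0#                       ∎
      where
      A = alternatingSum λ k → u (suc k) * N zero k
      B = λ j → alternatingSum λ k → u (suc (punchIn j k)) * N (suc j) (suc k)

    det-equal₀₁ : ∀ {n} (A : Matrix (suc (suc n))) → (∀ j → A zero j ≈ A (suc zero) j) → det A ≈ 0#
    det-equal₀₁ A eq = trans
      (alt-cong λ j → *-congˡ {A zero j} (alt-cong λ k →
        *-congʳ {det λ i c → A (suc (suc i)) (punchIn j (punchIn k c))} (sym (eq (punchIn j k)))))
      (double-expansion _ (A zero) (λ j k → det λ i c → A (suc (suc i)) (punchIn j (punchIn k c))) λ p q →
        det-cong λ i c → reflexive (≡.cong (A (suc (suc i))) (punchIn-punchIn p q c)))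

    det-zero-minors : ∀ {n} (A : Matrix (suc n)) →
      (∀ j → det (λ i k → A (suc i) (punchIn j k)) ≈ 0#) → det A ≈ 0#
    det-zero-minors A eq = alt-zero λ j → trans (*-congˡ (eq j)) (zeroʳ _)

    det-antisym : ∀ {n} (r r′ : Fin n) → r ≢ r′ →
      (∀ (A : Matrix n) → (∀ j → A r j ≈ A r′ j) → det A ≈ 0#) →
      ∀ (A B : Matrix n) → (∀ j → B r j ≈ A r′ j) → (∀ j → B r′ j ≈ A r j) →
      (∀ i → i ≢ r → i ≢ r′ → ∀ j → B i j ≈ A i j) →
      det B ≈ s * det A
    det-antisym {n} r r′ r≢r′ alt A B B≈A′ B′≈A B≈A = begin
      det B                                ≈⟨ +-identityˡ _ ⟨
      0# + det B                           ≈⟨ +-congʳ (trans (*-congʳ 1+s) (zeroˡ _)) ⟨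
      (1# + s) * det A + det B             ≈⟨ solve 3 (λ t a b → (con 1 :+ t) :* a :+ b := t :* a :+ (con 1 :* b :+ con 1 :* a)) refl s (det A) (det B) ⟩
      s * det A + (1# * det B + 1# * det A) ≈⟨ +-congˡ key ⟩
      s * det A + 0#                       ≈⟨ +-identityʳ _ ⟩
      s * det A                            ∎
      where
      u v w : Fin n → Carrier
      u = A r
      v = A r′
      w j = u j + 1# * v j
      M : (Fin n → Carrier) → (Fin n → Carrier) → Matrix n
      M p q = updateAt (updateAt A r (const p)) r′ (const q)
      at-r′ : ∀ p q j → M p q r′ j ≈ q j
      at-r′ p q j = reflexive (≡.cong-app (updateAt-updates r′ _) j)
      at-r : ∀ p q j → M p q r j ≈ p j
      at-r p q j = reflexive (≡.cong-app (≡.trans (updateAt-minimal r r′ _ r≢r′) (updateAt-updates r A)) j)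
      at-i : ∀ p q i → i ≢ r → i ≢ r′ → ∀ j → M p q i j ≈ A i j
      at-i p q i i≢r i≢r′ j = reflexive (≡.cong-app (≡.trans (updateAt-minimal i r′ _ i≢r′) (updateAt-minimal i r A i≢r)) j)
      off : ∀ p q p′ q′ → (∀ j → q j ≈ q′ j) → ∀ i → i ≢ r → ∀ j → M p q i j ≈ M p′ q′ i j
      off p q p′ q′ q≈q′ i i≢r j with i Fin.≟ r′
      ... | yes ≡.refl = trans (at-r′ p q j) (trans (q≈q′ j) (sym (at-r′ p′ q′ j)))
      ... | no i≢r′    = trans (at-i p q i i≢r i≢r′ j) (sym (at-i p′ q′ i i≢r i≢r′ j))
      off′ : ∀ p q q′ i → i ≢ r′ → ∀ j → M p q i j ≈ M p q′ i j
      off′ p q q′ i i≢r′ j with i Fin.≟ r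
      ... | yes ≡.refl = trans (at-r p q j) (sym (at-r p q′ j))
      ... | no i≢r     = trans (at-i p q i i≢r i≢r′ j) (sym (at-i p q′ i i≢r i≢r′ j))
      same : ∀ p → det (M p p) ≈ 0#
      same p = alt (M p p) λ j → trans (at-r p p j) (sym (at-r′ p p j))
      splitʳ : ∀ p → det (M p w) ≈ det (M p u) + 1# * det (M p v)
      splitʳ p = det-linear r′ 1# (off′ p u w) (off′ p v w)
        (λ j → trans (at-r′ p w j) (sym (+-cong (at-r′ p u j) (*-congˡ (at-r′ p v j)))))
      splitˡ : ∀ q → det (M w q) ≈ det (M u q) + 1# * det (M v q)
      splitˡ q = det-linear r 1# (off u q w q λ _ → refl) (off v q w q λ _ → refl)
        (λ j → trans (at-r w q j) (sym (+-cong (at-r u q j) (*-congˡ (at-r v q j)))))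
      M≈ : ∀ C p q → (∀ j → C r j ≈ p j) → (∀ j → C r′ j ≈ q j) →
           (∀ i → i ≢ r → i ≢ r′ → ∀ j → C i j ≈ A i j) → det C ≈ det (M p q)
      M≈ C p q Cr Cr′ Ci = det-cong go
        where
        go : ∀ i j → C i j ≈ M p q i j
        go i j with i Fin.≟ r | i Fin.≟ r′
        ... | yes ≡.refl | _          = trans (Cr j) (sym (at-r p q j))
        ... | no i≢r     | yes ≡.refl = trans (Cr′ j) (sym (at-r′ p q j))
        ... | no i≢r     | no i≢r′    = trans (Ci i i≢r i≢r′ j) (sym (at-i p q i i≢r i≢r′ j))
      key : 1# * det B + 1# * det A ≈ 0#
      key = begin
        1# * det B + 1# * det A
          ≈⟨ +-cong (*-congˡ (M≈ B v u B≈A′ B′≈A B≈A)) (*-congˡ (M≈ A u v (λ _ → refl) (λ _ → refl) (λ _ _ _ _ → refl))) ⟩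
        1# * det (M v u) + 1# * det (M u v)
          ≈⟨ solve 2 (λ a b → con 1 :* a :+ con 1 :* b := (con 0 :+ con 1 :* a) :+ con 1 :* (b :+ con 1 :* con 0)) refl _ _ ⟩
        (0# + 1# * det (M v u)) + 1# * (det (M u v) + 1# * 0#)
          ≈⟨ +-cong (+-congʳ (same u)) (*-congˡ (+-congˡ (*-congˡ (same v)))) ⟨
        (det (M u u) + 1# * det (M v u)) + 1# * (det (M u v) + 1# * det (M v v))
          ≈⟨ +-cong (splitˡ u) (*-congˡ (splitˡ v)) ⟨
        det (M w u) + 1# * det (M w v)
          ≈⟨ splitʳ w ⟨
        det (M w w)
          ≈⟨ same w ⟩
        0# ∎

    det-equal₀ : ∀ {n} (A : Matrix (suc n)) r → (∀ j → A zero j ≈ A (suc r) j) → det A ≈ 0#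
    det-equal₀ A zero    eq = det-equal₀₁ A eq
    det-equal₀ {suc n} A (suc r) eq = begin
      det A     ≈⟨ det-antisym zero (suc zero) (λ ()) det-equal₀₁ B A (λ _ → refl) (λ _ → refl)
                     (λ { zero i≢0 _ _ → ⊥-elim (i≢0 ≡.refl)
                        ; (suc zero) _ i≢1 _ → ⊥-elim (i≢1 ≡.refl)
                        ; (suc (suc i)) _ _ _ → refl }) ⟩
      s * det B ≈⟨ *-congˡ (det-zero-minors B λ j → det-equal₀ (λ i k → B (suc i) (punchIn j k)) r λ k → eq (punchIn j k)) ⟩
      s * 0#    ≈⟨ zeroʳ s ⟩
      0#        ∎
      where
      B : Matrix (suc (suc n))
      B zero          = A (suc zero)
      B (suc zero)    = A zero
      B (suc (suc i)) = A (suc (suc i))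

  det-equal : ∀ {n} (r r′ : Fin n) → r ≢ r′ → (A : Matrix n) → (∀ j → A r j ≈ A r′ j) → det A ≈ 0#
  det-equal zero    zero     r≢r′ A eq = ⊥-elim (r≢r′ ≡.refl)
  det-equal zero    (suc r′) r≢r′ A eq = det-equal₀ A r′ eq
  det-equal (suc r) zero     r≢r′ A eq = det-equal₀ A r (sym ∘ eq)
  det-equal (suc r) (suc r′) r≢r′ A eq = det-zero-minors A λ j →
    det-equal r r′ (r≢r′ ∘ ≡.cong suc) (λ i k → A (suc i) (punchIn j k)) λ k → eq (punchIn j k)

  det-swap : ∀ {n} (r r′ : Fin n) → r ≢ r′ → (A B : Matrix n) →
             (∀ j → B r j ≈ A r′ j) → (∀ j → B r′ j ≈ A r j) →
             (∀ i → i ≢ r → i ≢ r′ → ∀ j → B i j ≈ A i j) →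
             det B ≈ - det A
  det-swap r r′ r≢r′ A B p q t =
    trans (det-antisym r r′ r≢r′ (det-equal r r′ r≢r′) A B p q t) (-1*x≈-x _)

  private
    record Alternating {m n} (u : Fin n → Carrier) (F : (Fin m → Fin n → Carrier) → Carrier) : Set (c ⊔ ℓ) where
      field
        cong   : ∀ {A B} → (∀ i j → A i j ≈ B i j) → F A ≈ F B
        linear : ∀ r {A B C} a →
                 (∀ i → i ≢ r → ∀ j → A i j ≈ C i j) →
                 (∀ i → i ≢ r → ∀ j → B i j ≈ C i j) →
                 (∀ j → C r j ≈ A r j + a * B r j) → F C ≈ F A + a * F B
        vanish : ∀ r {A} → (∀ j → A r j ≈ u j) → F A ≈ 0#

    add-multiples : ∀ {m n} {u : Fin n → Carrier} {F : (Fin m → Fin n → Carrier) → Carrier} →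
      Alternating u F → ∀ {A C} → (∀ i j → C i j ≈ A i j + u j) → F C ≈ F A
    add-multiples {zero}  alt C≈ = Alternating.cong alt λ ()
    add-multiples {suc m} {n} {u} {F} alt {A} {C} C≈ = begin
      F C                                           ≈⟨ linear zero {A zero ◂ C ∘ suc} {u ◂ C ∘ suc} 1#
                                                         (λ { zero 0≢0 → ⊥-elim (0≢0 ≡.refl) ; (suc i) _ j → refl })
                                                         (λ { zero 0≢0 → ⊥-elim (0≢0 ≡.refl) ; (suc i) _ j → refl })
                                                         (λ j → trans (C≈ zero j) (+-congˡ (sym (*-identityˡ _)))) ⟩
      F (A zero ◂ C ∘ suc) + 1# * F (u ◂ C ∘ suc)   ≈⟨ +-congˡ (*-congˡ (vanish zero λ _ → refl)) ⟩
      F (A zero ◂ C ∘ suc) + 1# * 0#                ≈⟨ trans (+-congˡ (zeroʳ _)) (+-identityʳ _) ⟩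
      F (A zero ◂ C ∘ suc)                          ≈⟨ add-multiples fixed-head (C≈ ∘ suc) ⟩
      F (A zero ◂ A ∘ suc)                          ≈⟨ cong (λ { zero j → refl ; (suc i) j → refl }) ⟩
      F A                                           ∎
      where
      open Alternating alt
      infixr 5 _◂_
      _◂_ : ∀ {m} → (Fin n → Carrier) → (Fin m → Fin n → Carrier) → Fin (suc m) → Fin n → Carrier
      (v ◂ M) zero    = v
      (v ◂ M) (suc i) = M i
      fixed-head : Alternating u λ M → F (A zero ◂ M)
      fixed-head = record
        { cong   = λ A≈B → cong λ { zero j → refl ; (suc i) j → A≈B i j }
        ; linear = λ r a A≈C B≈C C≈A+aB → linear (suc r) a
            (λ { zero _ j → refl ; (suc i) i≢r → A≈C i (i≢r ∘ ≡.cong suc) })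
            (λ { zero _ j → refl ; (suc i) i≢r → B≈C i (i≢r ∘ ≡.cong suc) })
            C≈A+aB
        ; vanish = λ r → vanish (suc r)
        }

    -- Univariate polynomials as coefficient lists, constant term first.
    ⟦_⟧ : List Carrier → Carrier → Carrier
    ⟦ []    ⟧ t = 0#
    ⟦ a ∷ f ⟧ t = a + t * ⟦ f ⟧ t

    _⊞_ : List Carrier → List Carrier → List Carrier
    []      ⊞ g       = g
    (a ∷ f) ⊞ []      = a ∷ f
    (a ∷ f) ⊞ (b ∷ g) = a + b ∷ f ⊞ g

    -- ⟦ f ÷ y ⟧ t = (⟦ f ⟧ t - ⟦ f ⟧ y) / (t - y)
    _÷_ : List Carrier → Carrier → List Carrier
    []      ÷ y = []
    (a ∷ f) ÷ y = f ⊞ map (y *_) (f ÷ y)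

    ⟦⟧-⊞ : ∀ f g t → ⟦ f ⊞ g ⟧ t ≈ ⟦ f ⟧ t + ⟦ g ⟧ t
    ⟦⟧-⊞ []      g       t = sym (+-identityˡ _)
    ⟦⟧-⊞ (a ∷ f) []      t = sym (+-identityʳ _)
    ⟦⟧-⊞ (a ∷ f) (b ∷ g) t = trans (+-congˡ (*-congˡ (⟦⟧-⊞ f g t)))
      (solve 5 (λ a b t x y → a :+ b :+ t :* (x :+ y) := a :+ t :* x :+ (b :+ t :* y)) refl a b t (⟦ f ⟧ t) (⟦ g ⟧ t))

    ⟦⟧-map : ∀ y f t → ⟦ map (y *_) f ⟧ t ≈ y * ⟦ f ⟧ t
    ⟦⟧-map y []      t = sym (zeroʳ y)
    ⟦⟧-map y (a ∷ f) t = trans (+-congˡ (*-congˡ (⟦⟧-map y f t)))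
      (solve 4 (λ y a t x → y :* a :+ t :* (y :* x) := y :* (a :+ t :* x)) refl y a t (⟦ f ⟧ t))

    ÷-correct : ∀ f t y → ⟦ f ⟧ t ≈ (t - y) * ⟦ f ÷ y ⟧ t + ⟦ f ⟧ y
    ÷-correct []      t y = sym (trans (+-identityʳ _) (zeroʳ _))
    ÷-correct (a ∷ f) t y = begin
      a + t * ⟦ f ⟧ t
        ≈⟨ +-congˡ (*-congʳ t≈d+y) ⟩
      a + (d + y) * ⟦ f ⟧ t
        ≈⟨ solve 4 (λ a d y x → a :+ (d :+ y) :* x := a :+ d :* x :+ y :* x) refl a d y (⟦ f ⟧ t) ⟩
      a + d * ⟦ f ⟧ t + y * ⟦ f ⟧ t
        ≈⟨ +-congˡ (*-congˡ (÷-correct f t y)) ⟩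
      a + d * ⟦ f ⟧ t + y * (d * ⟦ f ÷ y ⟧ t + ⟦ f ⟧ y)
        ≈⟨ solve 6 (λ a d y x q z → a :+ d :* x :+ y :* (d :* q :+ z) := d :* (x :+ y :* q) :+ (a :+ y :* z)) refl a d y (⟦ f ⟧ t) (⟦ f ÷ y ⟧ t) (⟦ f ⟧ y) ⟩
      d * (⟦ f ⟧ t + y * ⟦ f ÷ y ⟧ t) + (a + y * ⟦ f ⟧ y)
        ≈⟨ +-congʳ (*-congˡ (trans (⟦⟧-⊞ f _ t) (+-congˡ (⟦⟧-map y (f ÷ y) t)))) ⟨
      d * ⟦ (a ∷ f) ÷ y ⟧ t + ⟦ a ∷ f ⟧ y ∎
      where
      d = t - y
      t≈d+y : t ≈ d + y
      t≈d+y = sym (trans (+-assoc t _ _) (trans (+-congˡ (-‿inverseˡ y)) (+-identityʳ t)))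

    cofactor : ∀ n → (Fin n → Carrier) → (Fin n → List Carrier) → Carrier
    cofactor zero    x f = 1#
    cofactor (suc n) x f = alternatingSum λ j →
      ⟦ f j ⟧ (x zero) * cofactor n (x ∘ suc) λ k → f (punchIn j k) ÷ x zero

  vandermonde : ∀ n → (Fin n → Carrier) → Carrier
  vandermonde zero    x = 1#
  vandermonde (suc n) x = product (λ i → x (suc i) - x zero) * vandermonde n (x ∘ suc)

  private
    factorise : ∀ n (x : Fin n → Carrier) (f : Fin n → List Carrier) →
                det (λ i j → ⟦ f j ⟧ (x i)) ≈ vandermonde n x * cofactor n x f
    factorise zero    x f = sym (*-identityˡ 1#)
    factorise (suc n) x f = begin
      det (λ i j → ⟦ f j ⟧ (x i))
        ≈⟨ det-cong {A = λ i j → ⟦ f j ⟧ (x i)} {topped λ i j → ⟦ f j ⟧ (x (suc i))} (λ { zero j → refl ; (suc i) j → refl }) ⟩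
      det (topped λ i j → ⟦ f j ⟧ (x (suc i)))
        ≈⟨ add-multiples alternating (λ i j → ÷-correct (f j) (x (suc i)) (x zero)) ⟩
      det (topped λ i j → d i * ⟦ f j ÷ x zero ⟧ (x (suc i)))
        ≈⟨ alt-cong (λ j → trans
             (*-congˡ (trans (det-scale d (λ i k → ⟦ f (punchIn j k) ÷ x zero ⟧ (x (suc i))))
                             (*-congˡ (factorise n (x ∘ suc) (λ k → f (punchIn j k) ÷ x zero)))))
             (solve 4 (λ a p v w → a :* (p :* (v :* w)) := p :* v :* (a :* w)) refl
               (⟦ f j ⟧ (x zero)) (product d) (vandermonde n (x ∘ suc)) (cofactor n (x ∘ suc) λ k → f (punchIn j k) ÷ x zero))) ⟩
      alternatingSum (λ j → product d * vandermonde n (x ∘ suc) * (⟦ f j ⟧ (x zero) * cofactor n (x ∘ suc) λ k → f (punchIn j k) ÷ x zero))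
        ≈⟨ alt-scale _ _ ⟩
      vandermonde (suc n) x * cofactor (suc n) x f ∎
      where
      d = λ i → x (suc i) - x zero
      topped : (Fin n → Fin (suc n) → Carrier) → Matrix (suc n)
      topped M zero    j = ⟦ f j ⟧ (x zero)
      topped M (suc i) j = M i j
      alternating : Alternating (λ j → ⟦ f j ⟧ (x zero)) (det ∘ topped)
      alternating = record
        { cong   = λ {A} {B} A≈B → det-cong {A = topped A} {topped B} λ { zero j → refl ; (suc i) j → A≈B i j }
        ; linear = λ r {A} {B} {C} a A≈C B≈C C≈A+aB → det-linear (suc r) {topped A} {topped B} {topped C} a
            (λ { zero _ j → refl ; (suc i) i≢r → A≈C i (i≢r ∘ ≡.cong suc) })
            (λ { zero _ j → refl ; (suc i) i≢r → B≈C i (i≢r ∘ ≡.cong suc) })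
            C≈A+aB
        ; vanish = λ r {A} A≈u → det-equal zero (suc r) (λ ()) (topped A) (λ j → sym (A≈u j))
        }

    data Monic : ℕ → List Carrier → Set (c ⊔ ℓ) where
      one  : ∀ {a} → a ≈ 1# → Monic 0 (a ∷ [])
      next : ∀ {d a f} → Monic d f → Monic (suc d) (a ∷ f)

    length-⊞ : ∀ f g → length g ≤ length f → length (f ⊞ g) ≡ length f
    length-⊞ []      []      z≤n       = ≡.refl
    length-⊞ (a ∷ f) []      z≤n       = ≡.refl
    length-⊞ (a ∷ f) (b ∷ g) (s≤s g≤f) = ≡.cong suc (length-⊞ f g g≤f)

    length-÷ : ∀ a f y → length ((a ∷ f) ÷ y) ≡ length f
    length-÷ a []      y = ≡.refl
    length-÷ a (b ∷ f) y = length-⊞ (b ∷ f) (map (y *_) ((b ∷ f) ÷ y)) (ℕ.≤-trans (ℕ.≤-reflexive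
      (≡.trans (length-map (y *_) ((b ∷ f) ÷ y)) (length-÷ b f y))) (ℕ.n≤1+n _))

    monic-⊞ : ∀ {d f} → Monic d f → ∀ g → length g ≤ d → Monic d (f ⊞ g)
    monic-⊞ (one a≈1) []      z≤n       = one a≈1
    monic-⊞ (next m)  []      z≤n       = next m
    monic-⊞ (next m)  (b ∷ g) (s≤s g≤d) = next (monic-⊞ m g g≤d)

    monic-length : ∀ {d f} → Monic d f → length f ≡ suc d
    monic-length (one _)  = ≡.refl
    monic-length (next m) = ≡.cong suc (monic-length m)

    monic-÷ : ∀ {d f} → Monic (suc d) f → ∀ y → Monic d (f ÷ y)
    monic-÷ {d} (next {f = f@(b ∷ f′)} m) y = monic-⊞ m (map (y *_) (f ÷ y)) (ℕ.≤-reflexive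
      (≡.trans (length-map (y *_) (f ÷ y)) (≡.trans (length-÷ b f′ y) (ℕ.suc-injective (monic-length m)))))

    cofactor-zero : ∀ n x f j → f j ≡ [] → cofactor n x f ≈ 0#
    cofactor-zero (suc n) x f j fj≡[] = alt-zero go
      where
      go : ∀ i → ⟦ f i ⟧ (x zero) * cofactor n (x ∘ suc) (λ k → f (punchIn i k) ÷ x zero) ≈ 0#
      go i with i Fin.≟ j
      ... | yes ≡.refl = trans (*-congʳ (reflexive (≡.cong (λ g → ⟦ g ⟧ (x zero)) fj≡[]))) (zeroˡ _)
      ... | no i≢j     = trans (*-congˡ (cofactor-zero n (x ∘ suc) _ (punchOut i≢j)
        (≡.cong (_÷ x zero) (≡.trans (≡.cong f (punchIn-punchOut i≢j)) fj≡[])))) (zeroʳ _)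

    sign : ℕ → Carrier
    sign zero    = 1#
    sign (suc n) = s ^ n * sign n

    sign² : ∀ n → sign n * sign n ≈ 1#
    sign² zero    = *-identityˡ 1#
    sign² (suc n) = begin
      s ^ n * sign n * (s ^ n * sign n)     ≈⟨ solve 2 (λ a b → a :* b :* (a :* b) := a :* a :* (b :* b)) refl (s ^ n) (sign n) ⟩
      s ^ n * s ^ n * (sign n * sign n)     ≈⟨ *-cong (power² n) (sign² n) ⟩
      1# * 1#                               ≈⟨ *-identityˡ 1# ⟩
      1#                                    ∎
      where
      power² : ∀ n → s ^ n * s ^ n ≈ 1#
      power² zero    = *-identityˡ 1#
      power² (suc n) = trans (solve 2 (λ a b → a :* b :* (a :* b) := a :* a :* (b :* b)) refl s (s ^ n))
                             (trans (*-cong s*s (power² n)) (*-identityˡ 1#))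

    cofactor-monic : ∀ n x f → (∀ j → Monic (staircase {n} j) (f j)) → cofactor n x f ≈ sign n
    cofactor-monic zero    x f monic = refl
    cofactor-monic (suc n) x f monic = begin
      cofactor (suc n) x f
        ≈⟨ alt-last n _ (λ j → trans (*-congˡ (cofactor-zero n (x ∘ suc) _ (pred-last j) (÷-last j))) (zeroʳ _)) ⟩
      s ^ n * (⟦ f (fromℕ n) ⟧ (x zero) * cofactor n (x ∘ suc) (λ k → f (punchIn (fromℕ n) k) ÷ x zero))
        ≈⟨ *-congˡ (*-cong ⟦last⟧ (cofactor-monic n (x ∘ suc) _ λ k →
             monic-÷ (≡.subst₂ Monic (staircase-suc k) ≡.refl (monic (punchIn (fromℕ n) k))) (x zero))) ⟩
      s ^ n * (1# * sign n)
        ≈⟨ *-congˡ (*-identityˡ _) ⟩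
      sign (suc n) ∎
      where
      last-monic : Monic 0 (f (fromℕ n))
      last-monic = ≡.subst (λ d → Monic d (f (fromℕ n)))
        (≡.trans (≡.cong (n ∸_) (toℕ-fromℕ n)) (ℕ.n∸n≡0 n)) (monic (fromℕ n))
      ⟦last⟧ : ⟦ f (fromℕ n) ⟧ (x zero) ≈ 1#
      ⟦last⟧ with f (fromℕ n) | last-monic
      ... | _ | one a≈1 = trans (+-cong a≈1 (zeroʳ _)) (+-identityʳ _)
      punchIn-last : ∀ {n} (k : Fin n) → toℕ (punchIn (fromℕ n) k) ≡ toℕ k
      punchIn-last zero    = ≡.refl
      punchIn-last (suc k) = ≡.cong suc (punchIn-last k)
      staircase-suc : ∀ k → staircase (punchIn (fromℕ n) k) ≡ suc (staircase k)
      staircase-suc k = ≡.trans (≡.cong (n ∸_) (punchIn-last k)) (ℕ.+-∸-assoc 1 (Fin.toℕ<n k))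
      inject₁≢last : (j : Fin n) → inject₁ j ≢ fromℕ n
      inject₁≢last j eq = Fin.fromℕ≢inject₁ (≡.sym eq)
      pred-last : Fin n → Fin n
      pred-last j = punchOut (inject₁≢last j)
      ÷-last : ∀ j → f (punchIn (inject₁ j) (pred-last j)) ÷ x zero ≡ []
      ÷-last j = ≡.trans (≡.cong (λ k → f k ÷ x zero) (punchIn-punchOut (inject₁≢last j))) (÷-const last-monic)
        where
        ÷-const : ∀ {g} → Monic 0 g → g ÷ x zero ≡ []
        ÷-const (one _) = ≡.refl

    monomial : ℕ → List Carrier
    monomial zero    = 1# ∷ []
    monomial (suc m) = 0# ∷ monomial m

    ⟦monomial⟧ : ∀ m t → ⟦ monomial m ⟧ t ≈ t ^ m
    ⟦monomial⟧ zero    t = trans (+-congˡ (zeroʳ t)) (+-identityʳ 1#)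
    ⟦monomial⟧ (suc m) t = trans (+-identityˡ _) (*-congˡ (⟦monomial⟧ m t))

    monic-monomial : ∀ m → Monic m (monomial m)
    monic-monomial zero    = one refl
    monic-monomial (suc m) = next (monic-monomial m)

    alternant-factorise : ∀ n x (μ : Fin n → ℕ) →
                          alternant x μ ≈ vandermonde n x * cofactor n x (monomial ∘ μ)
    alternant-factorise n x μ = trans
      (det-cong λ i j → sym (⟦monomial⟧ (μ j) (x i))) (factorise n x (monomial ∘ μ))

    alternant-staircase : ∀ n x → alternant x (staircase {n}) ≈ vandermonde n x * sign n
    alternant-staircase n x = trans (alternant-factorise n x staircase)
      (*-congˡ (cofactor-monic n x _ (monic-monomial ∘ staircase)))

  staircase∣alternant : ∀ {n} (x : Fin n → Carrier) (μ : Fin n → ℕ) → alternant x staircase ∣ alternant x μ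
  staircase∣alternant {n} x μ = sign n * w , (begin
    sign n * w * alternant x staircase  ≈⟨ *-congˡ (alternant-staircase n x) ⟩
    sign n * w * (v * sign n)           ≈⟨ solve 3 (λ e w v → e :* w :* (v :* e) := e :* e :* (v :* w)) refl (sign n) w v ⟩
    sign n * sign n * (v * w)           ≈⟨ trans (*-congʳ (sign² n)) (*-identityˡ _) ⟩
    v * w                               ≈⟨ alternant-factorise n x μ ⟨
    alternant x μ                       ∎)
    where
    v = vandermonde n x
    w = cofactor n x (monomial ∘ μ)

  staircase-cancel : ∀ {n} (x : Fin n → Carrier) →
    (∀ {i j} → i ≢ j → ∀ p → (x i - x j) * p ≈ 0# → p ≈ 0#) →
    ∀ p → alternant x staircase * p ≈ 0# → p ≈ 0#
  staircase-cancel {n} x cancel p eq = begin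
    p                          ≈⟨ *-identityˡ p ⟨
    1# * p                     ≈⟨ *-congʳ (sign² n) ⟨
    sign n * sign n * p        ≈⟨ *-assoc _ _ _ ⟩
    sign n * (sign n * p)      ≈⟨ *-congˡ (vandermonde-cancel n x cancel _
                                    (trans (sym (*-assoc _ _ p)) (trans (*-congʳ (sym (alternant-staircase n x))) eq))) ⟩
    sign n * 0#                ≈⟨ zeroʳ _ ⟩
    0#                         ∎
    where
    product-cancel : ∀ m (t : Fin m → Carrier) → (∀ i p → t i * p ≈ 0# → p ≈ 0#) → ∀ p → product t * p ≈ 0# → p ≈ 0#
    product-cancel zero    t t-cancel p eq = trans (sym (*-identityˡ p)) eq
    product-cancel (suc m) t t-cancel p eq = product-cancel m (t ∘ suc) (t-cancel ∘ suc) p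
      (t-cancel zero _ (trans (sym (*-assoc _ _ p)) eq))
    vandermonde-cancel : ∀ n (x : Fin n → Carrier) →
      (∀ {i j} → i ≢ j → ∀ p → (x i - x j) * p ≈ 0# → p ≈ 0#) → ∀ p → vandermonde n x * p ≈ 0# → p ≈ 0#
    vandermonde-cancel zero    x cancel p eq = trans (sym (*-identityˡ p)) eq
    vandermonde-cancel (suc n) x cancel p eq =
      vandermonde-cancel n (x ∘ suc) (λ i≢j → cancel (i≢j ∘ Fin.suc-injective)) p
        (product-cancel n (λ i → x (suc i) - x zero) (λ i → cancel λ ()) _ (trans (sym (*-assoc _ _ p)) eq))

-- The polynomial ring ℚ[x₁, …, xₙ], presented as the free commutative
-- ℚ-algebra on n generators: terms modulo the congruence _≋_ generated
-- by the axioms of commutative rings and the arithmetic of ℚ.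

infixl 7 _⊗_
infixl 6 _⊕_
infix  4 _≋_

data Poly (n : ℕ) : Set where
  con     : ℚ → Poly n
  var     : Fin n → Poly n
  _⊕_ _⊗_ : Poly n → Poly n → Poly n

data _≋_ {n} : Poly n → Poly n → Set where
  ≋-refl  : ∀ {p} → p ≋ p
  ≋-sym   : ∀ {p q} → p ≋ q → q ≋ p
  ≋-trans : ∀ {p q r} → p ≋ q → q ≋ r → p ≋ r
  ⊕-cong  : ∀ {p p′ q q′} → p ≋ p′ → q ≋ q′ → p ⊕ q ≋ p′ ⊕ q′
  ⊗-cong  : ∀ {p p′ q q′} → p ≋ p′ → q ≋ q′ → p ⊗ q ≋ p′ ⊗ q′
  ⊕-assoc     : ∀ p q r → (p ⊕ q) ⊕ r ≋ p ⊕ (q ⊕ r)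
  ⊕-comm      : ∀ p q → p ⊕ q ≋ q ⊕ p
  ⊕-identityˡ : ∀ p → con 0ℚ ⊕ p ≋ p
  ⊗-assoc     : ∀ p q r → (p ⊗ q) ⊗ r ≋ p ⊗ (q ⊗ r)
  ⊗-comm      : ∀ p q → p ⊗ q ≋ q ⊗ p
  ⊗-identityˡ : ∀ p → con 1ℚ ⊗ p ≋ p
  ⊗-zeroˡ     : ∀ p → con 0ℚ ⊗ p ≋ con 0ℚ
  distribʳ    : ∀ p q r → (q ⊕ r) ⊗ p ≋ q ⊗ p ⊕ r ⊗ p
  con-⊕       : ∀ a b → con (a ℚ.+ b) ≋ con a ⊕ con b
  con-⊗       : ∀ a b → con (a ℚ.* b) ≋ con a ⊗ con b

private
  ⊝_ : ∀ {n} → Poly n → Poly n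
  ⊝ p = con (ℚ.- 1ℚ) ⊗ p

  ⊝-inverseˡ : ∀ {n} (p : Poly n) → ⊝ p ⊕ p ≋ con 0ℚ
  ⊝-inverseˡ p = ≋-trans (⊕-cong ≋-refl (≋-sym (⊗-identityˡ p)))
    (≋-trans (≋-sym (distribʳ p _ _))
    (≋-trans (⊗-cong (≋-sym (con-⊕ (ℚ.- 1ℚ) 1ℚ)) ≋-refl) (⊗-zeroˡ p)))

polynomialRing : ℕ → CommutativeRing _ _
polynomialRing n = record
  { Carrier = Poly n
  ; _≈_ = _≋_
  ; _+_ = _⊕_
  ; _*_ = _⊗_
  ; -_  = ⊝_
  ; 0#  = con 0ℚ
  ; 1#  = con 1ℚ
  ; isCommutativeRing = record
    { isRing = record
      { +-isAbelianGroup = record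
        { isGroup = record
          { isMonoid = S.+-isMonoid
          ; inverse  = ⊝-inverseˡ , λ p → ≋-trans (⊕-comm p (⊝ p)) (⊝-inverseˡ p)
          ; ⁻¹-cong  = ⊗-cong ≋-refl
          }
        ; comm = ⊕-comm
        }
      ; *-cong     = ⊗-cong
      ; *-assoc    = ⊗-assoc
      ; *-identity = S.*-identity
      ; distrib    = S.distrib
      }
    ; *-comm = ⊗-comm
    }
  }
  where
  open import Algebra.Structures (_≋_ {n}) using (IsCommutativeSemiring)
  isSemiring : IsCommutativeSemiring _⊕_ _⊗_ (con 0ℚ) (con 1ℚ)
  isSemiring = isCommutativeSemiringˡ record
    { +-isCommutativeMonoid = isCommutativeMonoidˡ record
      { isSemigroup = record { isMagma = record { isEquivalence = equiv ; ∙-cong = ⊕-cong } ; assoc = ⊕-assoc }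
      ; identityˡ = ⊕-identityˡ
      ; comm = ⊕-comm
      }
    ; *-isCommutativeMonoid = isCommutativeMonoidˡ record
      { isSemigroup = record { isMagma = record { isEquivalence = equiv ; ∙-cong = ⊗-cong } ; assoc = ⊗-assoc }
      ; identityˡ = ⊗-identityˡ
      ; comm = ⊗-comm
      }
    ; distribʳ = distribʳ
    ; zeroˡ = ⊗-zeroˡ
    }
    where
    equiv : IsEquivalence (_≋_ {n})
    equiv = record { refl = ≋-refl ; sym = ≋-sym ; trans = ≋-trans }
  module S = IsCommutativeSemiring isSemiring

rename : ∀ {m n} → (Fin m → Fin n) → Poly m → Poly n
rename f (con a) = con a
rename f (var i) = var (f i)
rename f (p ⊕ q) = rename f p ⊕ rename f q
rename f (p ⊗ q) = rename f p ⊗ rename f q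

rename-cong : ∀ {m n} (f : Fin m → Fin n) {p q} → p ≋ q → rename f p ≋ rename f q
rename-cong f ≋-refl            = ≋-refl
rename-cong f (≋-sym e)         = ≋-sym (rename-cong f e)
rename-cong f (≋-trans e e′)    = ≋-trans (rename-cong f e) (rename-cong f e′)
rename-cong f (⊕-cong e e′)     = ⊕-cong (rename-cong f e) (rename-cong f e′)
rename-cong f (⊗-cong e e′)     = ⊗-cong (rename-cong f e) (rename-cong f e′)
rename-cong f (⊕-assoc p q r)   = ⊕-assoc _ _ _
rename-cong f (⊕-comm p q)      = ⊕-comm _ _
rename-cong f (⊕-identityˡ p)   = ⊕-identityˡ _
rename-cong f (⊗-assoc p q r)   = ⊗-assoc _ _ _
rename-cong f (⊗-comm p q)      = ⊗-comm _ _
rename-cong f (⊗-identityˡ p)   = ⊗-identityˡ _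
rename-cong f (⊗-zeroˡ p)       = ⊗-zeroˡ _
rename-cong f (distribʳ p q r)  = distribʳ _ _ _
rename-cong f (con-⊕ a b)       = con-⊕ a b
rename-cong f (con-⊗ a b)       = con-⊗ a b

private
  rename-≗ : ∀ {m n} {f g : Fin m → Fin n} → f ≗ g → ∀ p → rename f p ≡ rename g p
  rename-≗ f≗g (con a) = ≡.refl
  rename-≗ f≗g (var i) = ≡.cong var (f≗g i)
  rename-≗ f≗g (p ⊕ q) = ≡.cong₂ _⊕_ (rename-≗ f≗g p) (rename-≗ f≗g q)
  rename-≗ f≗g (p ⊗ q) = ≡.cong₂ _⊗_ (rename-≗ f≗g p) (rename-≗ f≗g q)

  rename-id : ∀ {n} (p : Poly n) → rename id p ≡ p
  rename-id (con a) = ≡.refl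
  rename-id (var i) = ≡.refl
  rename-id (p ⊕ q) = ≡.cong₂ _⊕_ (rename-id p) (rename-id q)
  rename-id (p ⊗ q) = ≡.cong₂ _⊗_ (rename-id p) (rename-id q)

  rename-∘ : ∀ {l m n} (g : Fin m → Fin n) (f : Fin l → Fin m) p → rename (g ∘ f) p ≡ rename g (rename f p)
  rename-∘ g f (con a) = ≡.refl
  rename-∘ g f (var i) = ≡.refl
  rename-∘ g f (p ⊕ q) = ≡.cong₂ _⊕_ (rename-∘ g f p) (rename-∘ g f q)
  rename-∘ g f (p ⊗ q) = ≡.cong₂ _⊗_ (rename-∘ g f p) (rename-∘ g f q)

module _ {n : ℕ} where
  open CommutativeRing (polynomialRing n) hiding (zero; distribʳ)
  open MonoidSum +-commutativeMonoid using (sum; sum-syntax; sum-cong-≋; sum-permute)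
  open Exp semiring using (_^_)
  open Determinant (polynomialRing n)
  open Solver commutativeSemiring using (solve; _:+_; _:*_; _:=_) renaming (con to κ)
  open RingProperties ring using (-‿distribʳ-*)
  open import Relation.Binary.Reasoning.Setoid setoid

  ∂ : Fin n → Poly n → Poly n
  ∂ i (con a) = 0#
  ∂ i (var j) = if does (i Fin.≟ j) then 1# else 0#
  ∂ i (p ⊕ q) = ∂ i p + ∂ i q
  ∂ i (p ⊗ q) = ∂ i p * q + p * ∂ i q

  ∂-cong : ∀ i {p q} → p ≈ q → ∂ i p ≈ ∂ i q
  ∂-cong i ≋-refl           = refl
  ∂-cong i (≋-sym e)        = sym (∂-cong i e)
  ∂-cong i (≋-trans e e′)   = trans (∂-cong i e) (∂-cong i e′)
  ∂-cong i (⊕-cong e e′)    = +-cong (∂-cong i e) (∂-cong i e′)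
  ∂-cong i (⊗-cong e e′)    = +-cong (*-cong (∂-cong i e) e′) (*-cong e (∂-cong i e′))
  ∂-cong i (⊕-assoc p q r)  = +-assoc _ _ _
  ∂-cong i (⊕-comm p q)     = +-comm _ _
  ∂-cong i (⊕-identityˡ p)  = +-identityˡ _
  ∂-cong i (⊗-assoc p q r)  = solve 6 (λ p p′ q q′ r r′ →
    (p′ :* q :+ p :* q′) :* r :+ p :* q :* r′ := p′ :* (q :* r) :+ p :* (q′ :* r :+ q :* r′))
    refl p (∂ i p) q (∂ i q) r (∂ i r)
  ∂-cong i (⊗-comm p q)     = solve 4 (λ p p′ q q′ → p′ :* q :+ p :* q′ := q′ :* p :+ q :* p′)
    refl p (∂ i p) q (∂ i q)
  ∂-cong i (⊗-identityˡ p)  = solve 2 (λ p p′ → κ 0 :* p :+ κ 1 :* p′ := p′) refl p (∂ i p)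
  ∂-cong i (⊗-zeroˡ p)      = solve 2 (λ p p′ → κ 0 :* p :+ κ 0 :* p′ := κ 0) refl p (∂ i p)
  ∂-cong i (distribʳ p q r) = solve 6 (λ p p′ q q′ r r′ →
    (q′ :+ r′) :* p :+ (q :+ r) :* p′ := (q′ :* p :+ q :* p′) :+ (r′ :* p :+ r :* p′))
    refl p (∂ i p) q (∂ i q) r (∂ i r)
  ∂-cong i (con-⊕ a b)      = sym (+-identityˡ _)
  ∂-cong i (con-⊗ a b)      = solve 2 (λ a b → κ 0 := κ 0 :* b :+ a :* κ 0) refl (con a) (con b)

  private
    module DividedDifference (i j : Fin n) (i≢j : i ≢ j) where
      -- p ↦ (p - p[xᵢ ≔ xⱼ]) / (xᵢ - xⱼ)
      to-j : Fin n → Fin n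
      to-j k = if does (k Fin.≟ i) then j else k

      σ Δ : Poly n → Poly n
      σ = rename to-j
      Δ (con a) = 0#
      Δ (var k) = if does (k Fin.≟ i) then 1# else 0#
      Δ (p ⊕ q) = Δ p + Δ q
      Δ (p ⊗ q) = Δ p * q + σ p * Δ q

      d : Poly n
      d = var i - var j

      expand : ∀ p → p ≈ σ p + d * Δ p
      expand (con a) = sym (trans (+-congˡ (zeroʳ d)) (+-identityʳ _))
      expand (var k) with k Fin.≟ i
      ... | yes ≡.refl = sym (begin
        var j + (var i - var j) * 1#  ≈⟨ +-congˡ (*-identityʳ _) ⟩
        var j + (var i - var j)       ≈⟨ +-congˡ (+-comm _ _) ⟩
        var j + (- var j + var i)     ≈⟨ +-assoc _ _ _ ⟨
        var j - var j + var i         ≈⟨ +-congʳ (-‿inverseʳ _) ⟩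
        0# + var i                    ≈⟨ +-identityˡ _ ⟩
        var i                         ∎)
      ... | no _ = sym (trans (+-congˡ (zeroʳ d)) (+-identityʳ _))
      expand (p ⊕ q) = trans (+-cong (expand p) (expand q))
        (solve 5 (λ a b x y d → a :+ d :* x :+ (b :+ d :* y) := a :+ b :+ d :* (x :+ y)) refl (σ p) (σ q) (Δ p) (Δ q) d)
      expand (p ⊗ q) = begin
        p * q                                      ≈⟨ *-congʳ (expand p) ⟩
        (σ p + d * Δ p) * q                        ≈⟨ solve 4 (λ a d x q → (a :+ d :* x) :* q := a :* q :+ d :* (x :* q)) refl (σ p) d (Δ p) q ⟩
        σ p * q + d * (Δ p * q)                    ≈⟨ +-congʳ (*-congˡ (expand q)) ⟩
        σ p * (σ q + d * Δ q) + d * (Δ p * q)      ≈⟨ solve 6 (λ a d x q b y → a :* (b :+ d :* y) :+ d :* (x :* q) := a :* b :+ d :* (x :* q :+ a :* y)) refl (σ p) d (Δ p) q (σ q) (Δ q) ⟩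
        σ p * σ q + d * (Δ p * q + σ p * Δ q)      ∎

      Δ-cong : ∀ {p q} → p ≈ q → Δ p ≈ Δ q
      Δ-cong ≋-refl           = refl
      Δ-cong (≋-sym e)        = sym (Δ-cong e)
      Δ-cong (≋-trans e e′)   = trans (Δ-cong e) (Δ-cong e′)
      Δ-cong (⊕-cong e e′)    = +-cong (Δ-cong e) (Δ-cong e′)
      Δ-cong (⊗-cong e e′)    = +-cong (*-cong (Δ-cong e) e′) (*-cong (rename-cong to-j e) (Δ-cong e′))
      Δ-cong (⊕-assoc p q r)  = +-assoc _ _ _
      Δ-cong (⊕-comm p q)     = +-comm _ _
      Δ-cong (⊕-identityˡ p)  = +-identityˡ _
      Δ-cong (⊗-assoc p q r)  = solve 7 (λ p p′ q q′ r r′ q₀ →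
        (p′ :* q₀ :+ p :* q′) :* r :+ p :* q :* r′ := p′ :* (q₀ :* r) :+ p :* (q′ :* r :+ q :* r′))
        refl (σ p) (Δ p) (σ q) (Δ q) r (Δ r) q
      Δ-cong (⊗-comm p q)     = begin
        Δ p * q + σ p * Δ q                   ≈⟨ +-congʳ (*-congˡ (expand q)) ⟩
        Δ p * (σ q + d * Δ q) + σ p * Δ q     ≈⟨ solve 5 (λ x b d y a → x :* (b :+ d :* y) :+ a :* y := y :* (a :+ d :* x) :+ b :* x) refl (Δ p) (σ q) d (Δ q) (σ p) ⟩
        Δ q * (σ p + d * Δ p) + σ q * Δ p     ≈⟨ +-congʳ (*-congˡ (expand p)) ⟨
        Δ q * p + σ q * Δ p                   ∎
      Δ-cong (⊗-identityˡ p)  = solve 2 (λ p p′ → κ 0 :* p :+ κ 1 :* p′ := p′) refl p (Δ p)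
      Δ-cong (⊗-zeroˡ p)      = solve 2 (λ p p′ → κ 0 :* p :+ κ 0 :* p′ := κ 0) refl p (Δ p)
      Δ-cong (distribʳ p q r) = solve 6 (λ p p′ q q′ r r′ →
        (q′ :+ r′) :* p :+ (q :+ r) :* p′ := (q′ :* p :+ q :* p′) :+ (r′ :* p :+ r :* p′))
        refl p (Δ p) (σ q) (Δ q) (σ r) (Δ r)
      Δ-cong (con-⊕ a b)      = sym (+-identityˡ _)
      Δ-cong (con-⊗ a b)      = solve 2 (λ a b → κ 0 := κ 0 :* b :+ a :* κ 0) refl (con a) (con b)

      σd≈0 : σ d ≈ 0#
      σd≈0 rewrite dec-true (i Fin.≟ i) ≡.refl | dec-false (j Fin.≟ i) (i≢j ∘ ≡.sym) = -‿inverseʳ (var j)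

      Δd≈1 : Δ d ≈ 1#
      Δd≈1 rewrite dec-true (i Fin.≟ i) ≡.refl | dec-false (j Fin.≟ i) (i≢j ∘ ≡.sym) =
        solve 2 (λ x c → κ 1 :+ (κ 0 :* x :+ c :* κ 0) := κ 1) refl (var j) (con (ℚ.- 1ℚ))

      cancel : ∀ p → d * p ≈ 0# → p ≈ 0#
      cancel p dp≈0 = begin
        p                     ≈⟨ solve 2 (λ p x → p := κ 1 :* p :+ κ 0 :* x) refl p (Δ p) ⟩
        1# * p + 0# * Δ p     ≈⟨ +-cong (*-congʳ Δd≈1) (*-congʳ σd≈0) ⟨
        Δ d * p + σ d * Δ p   ≈⟨ Δ-cong dp≈0 ⟩
        0#                    ∎

  a : (Fin n → ℕ) → Poly n
  a = alternant var

  δ : Fin n → ℕ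
  δ = staircase

  a-δ-cancel : ∀ p → a δ * p ≈ 0# → p ≈ 0#
  a-δ-cancel = staircase-cancel var λ {i} {j} i≢j → DividedDifference.cancel i j i≢j

  private
    rename-sum : ∀ {m} (f : Fin n → Fin n) (t : Fin m → Poly n) → rename f (sum t) ≡ sum (rename f ∘ t)
    rename-sum {zero}  f t = ≡.refl
    rename-sum {suc m} f t = ≡.cong (rename f (t zero) +_) (rename-sum f (t ∘ suc))

    rename-^ : ∀ (f : Fin n → Fin n) p k → rename f (p ^ k) ≡ rename f p ^ k
    rename-^ f p zero    = ≡.refl
    rename-^ f p (suc k) = ≡.cong (rename f p *_) (rename-^ f p k)

    opaque
      unfolding alternatingSum

      rename-alternatingSum : ∀ {m} (f : Fin n → Fin n) (t : Fin m → Poly n) →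
                              rename f (alternatingSum t) ≈ alternatingSum (rename f ∘ t)
      rename-alternatingSum f t = trans (reflexive (rename-sum f (λ j → (- 1#) ^ toℕ j * t j)))
        (sum-cong-≋ λ j → *-congʳ {rename f (t j)} (reflexive (rename-^ f (- 1#) (toℕ j))))

    rename-det : ∀ {m} (f : Fin n → Fin n) (M : Matrix m) → rename f (det M) ≈ det λ i j → rename f (M i j)
    rename-det {zero}  f M = refl
    rename-det {suc m} f M = trans (rename-alternatingSum f _)
      (alt-cong λ j → *-congˡ (rename-det f λ i k → M (suc i) (punchIn j k)))

    transpose-a : ∀ i j → i ≢ j → ∀ μ → rename (transpose i j ⟨$⟩ʳ_) (a μ) ≈ - a μ
    transpose-a i j i≢j μ = trans (rename-det τ (λ k l → var k ^ μ l))
      (det-swap i j i≢j (λ k l → var k ^ μ l) _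
        (λ l → reflexive (≡.trans (rename-^ τ (var i) (μ l)) (≡.cong (λ k → var k ^ μ l) τi≡j)))
        (λ l → reflexive (≡.trans (rename-^ τ (var j) (μ l)) (≡.cong (λ k → var k ^ μ l) τj≡i)))
        (λ k k≢i k≢j l → reflexive (≡.trans (rename-^ τ (var k) (μ l)) (≡.cong (λ k → var k ^ μ l) (τk≡k k k≢i k≢j)))))
      where
      τ = transpose i j ⟨$⟩ʳ_
      τi≡j : τ i ≡ j
      τi≡j rewrite dec-true (i Fin.≟ i) ≡.refl = ≡.refl
      τj≡i : τ j ≡ i
      τj≡i rewrite dec-false (j Fin.≟ i) (i≢j ∘ ≡.sym) | dec-true (j Fin.≟ j) ≡.refl = ≡.refl
      τk≡k : ∀ k → k ≢ i → k ≢ j → τ k ≡ k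
      τk≡k k k≢i k≢j rewrite dec-false (k Fin.≟ i) k≢i | dec-false (k Fin.≟ j) k≢j = ≡.refl

    transpose-self : ∀ (i : Fin n) k → transpose i i ⟨$⟩ʳ k ≡ k
    transpose-self i k with k Fin.≟ i
    ... | yes ≡.refl = ≡.refl
    ... | no k≢i rewrite dec-false (k Fin.≟ i) k≢i = ≡.refl

  Symmetric : Poly n → Set
  Symmetric p = ∀ (π : Permutation′ n) → rename (π ⟨$⟩ʳ_) p ≈ p

  private
    transpositions⇒symmetric : ∀ p → (∀ i j → i ≢ j → rename (transpose i j ⟨$⟩ʳ_) p ≈ p) → Symmetric p
    transpositions⇒symmetric p fixed π =
      trans (reflexive (≡.sym (rename-≗ (eval-decompose π) p))) (go (decompose π))
      where
      go : ∀ ts → rename (eval ts ⟨$⟩ʳ_) p ≈ p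
      go []             = reflexive (rename-id p)
      go ((i , j) ∷ ts) = trans (reflexive (rename-∘ (eval ts ⟨$⟩ʳ_) (transpose i j ⟨$⟩ʳ_) p))
                                (trans (rename-cong (eval ts ⟨$⟩ʳ_) (one i j)) (go ts))
        where
        one : ∀ i j → rename (transpose i j ⟨$⟩ʳ_) p ≈ p
        one i j with i Fin.≟ j
        ... | yes ≡.refl = reflexive (≡.trans (rename-≗ (transpose-self i) p) (rename-id p))
        ... | no i≢j     = fixed i j i≢j

  quotient-symmetric : ∀ s μ → s * a δ ≈ a μ → Symmetric s
  quotient-symmetric s μ s*a≈a = transpositions⇒symmetric s λ i j i≢j →
    let τs = rename (transpose i j ⟨$⟩ʳ_) s in
    x-y≈0⇒x≈y τs s (a-δ-cancel _ (begin
      a δ * (τs - s)                        ≈⟨ distribˡ _ _ _ ⟩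
      a δ * τs + a δ * - s                  ≈⟨ +-cong (*-comm _ _) (trans (sym (-‿distribʳ-* _ _)) (-‿cong (trans (*-comm _ _) s*a≈a))) ⟩
      τs * a δ - a μ                        ≈⟨ +-congˡ (sym (transpose-a i j i≢j μ)) ⟩
      τs * a δ + rename _ (a μ)             ≈⟨ +-congˡ (rename-cong _ (sym s*a≈a)) ⟩
      τs * a δ + τs * rename _ (a δ)        ≈⟨ +-congˡ (trans (*-congˡ (transpose-a i j i≢j δ)) (sym (-‿distribʳ-* _ _))) ⟩
      τs * a δ - τs * a δ                   ≈⟨ -‿inverseʳ _ ⟩
      0#                                    ∎))
    where
    x-y≈0⇒x≈y : ∀ x y → x - y ≈ 0# → x ≈ y
    x-y≈0⇒x≈y x y x-y≈0 = begin
      x               ≈⟨ +-identityʳ x ⟨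
      x + 0#          ≈⟨ +-congˡ (-‿inverseˡ y) ⟨
      x + (- y + y)   ≈⟨ +-assoc _ _ _ ⟨
      x - y + y       ≈⟨ +-congʳ x-y≈0 ⟩
      0# + y          ≈⟨ +-identityˡ y ⟩
      y               ∎

  d₊ d₀ d₋ : Poly n → Poly n
  d₊ p = ∑[ i < n ] (var i ^ 2 * ∂ i p)
  d₀ p = con (fromℤ (ℤ.+ 2)) * ∑[ i < n ] (var i * ∂ i p)
  d₋ p = - ∑[ i < n ] ∂ i p

  private
    permutation-injective : ∀ (π : Permutation′ n) {i j} → π ⟨$⟩ʳ i ≡ π ⟨$⟩ʳ j → i ≡ j
    permutation-injective π eq = ≡.trans (≡.sym (inverseˡ π)) (≡.trans (≡.cong (π ⟨$⟩ˡ_) eq) (inverseˡ π))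

    rename-∂ : ∀ (π : Permutation′ n) i p → rename (π ⟨$⟩ʳ_) (∂ i p) ≈ ∂ (π ⟨$⟩ʳ i) (rename (π ⟨$⟩ʳ_) p)
    rename-∂ π i (con b) = refl
    rename-∂ π i (var j) with i Fin.≟ j
    ... | yes ≡.refl rewrite dec-true ((π ⟨$⟩ʳ i) Fin.≟ (π ⟨$⟩ʳ i)) ≡.refl = refl
    ... | no i≢j rewrite dec-false ((π ⟨$⟩ʳ i) Fin.≟ (π ⟨$⟩ʳ j)) (i≢j ∘ permutation-injective π) = refl
    rename-∂ π i (p ⊕ q) = +-cong (rename-∂ π i p) (rename-∂ π i q)
    rename-∂ π i (p ⊗ q) = +-cong (*-congʳ (rename-∂ π i p)) (*-congˡ (rename-∂ π i q))

    sum-symmetric : ∀ (T : Fin n → Poly n → Poly n) →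
      (∀ i {p q} → p ≈ q → T i p ≈ T i q) →
      (∀ (π : Permutation′ n) i p → rename (π ⟨$⟩ʳ_) (T i p) ≈ T (π ⟨$⟩ʳ i) (rename (π ⟨$⟩ʳ_) p)) →
      ∀ p → Symmetric p → Symmetric (∑[ i < n ] T i p)
    sum-symmetric T T-cong T-rename p p-sym π = begin
      rename ρ (∑[ i < n ] T i p)      ≈⟨ reflexive (rename-sum ρ (λ i → T i p)) ⟩
      ∑[ i < n ] rename ρ (T i p)      ≈⟨ sum-cong-≋ (λ i → trans (T-rename π i p) (T-cong (ρ i) (p-sym π))) ⟩
      ∑[ i < n ] T (ρ i) p             ≈⟨ sum-permute (λ i → T i p) π ⟨
      ∑[ i < n ] T i p                 ∎
      where ρ = π ⟨$⟩ʳ_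

  d₊-symmetric : ∀ p → Symmetric p → Symmetric (d₊ p)
  d₊-symmetric = sum-symmetric (λ i p → var i ^ 2 * ∂ i p)
    (λ i e → *-congˡ (∂-cong i e)) (λ π i p → *-congˡ (rename-∂ π i p))

  d₀-symmetric : ∀ p → Symmetric p → Symmetric (d₀ p)
  d₀-symmetric p p-sym π = *-congˡ (sum-symmetric (λ i p → var i * ∂ i p)
    (λ i e → *-congˡ (∂-cong i e)) (λ π i p → *-congˡ (rename-∂ π i p)) p p-sym π)

  d₋-symmetric : ∀ p → Symmetric p → Symmetric (d₋ p)
  d₋-symmetric p p-sym π = -‿cong (sum-symmetric ∂ ∂-cong rename-∂ p p-sym π)

record Λ (n : ℕ) : Set where
  constructor mkΛ
  field
    polynomial : Poly n
    symmetric  : Symmetric polynomial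
open Λ public

private
  Λ-rawRing : ℕ → RawRing _ _
  Λ-rawRing n = record
    { Carrier = Λ n
    ; _≈_ = λ p q → polynomial p ≋ polynomial q
    ; _+_ = λ (mkΛ p p-sym) (mkΛ q q-sym) → mkΛ (p ⊕ q) λ π → ⊕-cong (p-sym π) (q-sym π)
    ; _*_ = λ (mkΛ p p-sym) (mkΛ q q-sym) → mkΛ (p ⊗ q) λ π → ⊗-cong (p-sym π) (q-sym π)
    ; -_  = λ (mkΛ p p-sym) → mkΛ (⊝ p) λ π → ⊗-cong ≋-refl (p-sym π)
    ; 0#  = mkΛ (con 0ℚ) λ π → ≋-refl
    ; 1#  = mkΛ (con 1ℚ) λ π → ≋-refl
    }

  polynomial-isRingMonomorphism : ∀ n →
    IsRingMonomorphism (Λ-rawRing n) (CommutativeRing.rawRing (polynomialRing n)) polynomial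
  polynomial-isRingMonomorphism n = record
    { isRingHomomorphism = record
      { isSemiringHomomorphism = record
        { isNearSemiringHomomorphism = record
          { +-isMonoidHomomorphism = record
            { isMagmaHomomorphism = record
              { isRelHomomorphism = record { cong = id }
              ; homo = λ _ _ → ≋-refl
              }
            ; ε-homo = ≋-refl
            }
          ; *-homo = λ _ _ → ≋-refl
          }
        ; 1#-homo = ≋-refl
        }
      ; -‿homo = λ _ → ≋-refl
      }
    ; injective = id
    }

symmetricRing : ℕ → CommutativeRing _ _
symmetricRing n = record
  { isCommutativeRing = RingMonomorphism.isCommutativeRing (polynomial-isRingMonomorphism n)
      (CommutativeRing.isCommutativeRing (polynomialRing n))
  }

infixr 8 _·_
_·_ : ∀ {n} → ℚ → Λ n → Λ n
c · mkΛ p p-sym = mkΛ (con c ⊗ p) λ π → ⊗-cong ≋-refl (p-sym π)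

D₊ D₀ D₋ : ∀ {n} → Λ n → Λ n
D₊ (mkΛ p p-sym) = mkΛ (d₊ p) (d₊-symmetric p p-sym)
D₀ (mkΛ p p-sym) = mkΛ (d₀ p) (d₀-symmetric p p-sym)
D₋ (mkΛ p p-sym) = mkΛ (d₋ p) (d₋-symmetric p p-sym)

record 𝒴 (n : ℕ) : Set where
  field
    part       : Fin n → ℕ
    decreasing : ∀ i j → i Fin.≤ j → part j ℕ.≤ part i
open 𝒴 public

∣_∣ : ∀ {n} → 𝒴 n → ℕ
∣ ν ∣ = sum (part ν)
  where open MonoidSum ℕ.+-0-commutativeMonoid using (sum)

-- Rows and columns are numbered from 0, which leaves contents unchanged.
Cell : ℕ → Set
Cell n = Fin n × ℕ

content : ∀ {n} → Cell n → ℤ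
content (i , j) = ℤ.+ j ℤ.- ℤ.+ toℕ i

infix 4 _∈_ _∉_ _⋖[_]_

_∈_ _∉_ : ∀ {n} → Cell n → 𝒴 n → Set
(i , j) ∈ ν = j ℕ.< part ν i
□ ∉ ν = ¬ (□ ∈ ν)

-- μ ⋖[ □ ] ν: the diagram of ν is the diagram of μ together with the cell □.
_⋖[_]_ : ∀ {n} → 𝒴 n → Cell n → 𝒴 n → Set
μ ⋖[ □ ] ν = □ ∉ μ × (∀ c → c ∈ ν ⇔ (c ∈ μ ⊎ c ≡ □))

private
  ≤-from-< : ∀ {m n} → (∀ k → k ℕ.< m → k ℕ.< n) → m ℕ.≤ n
  ≤-from-< {zero}  h = z≤n
  ≤-from-< {suc m} h = h m ℕ.≤-refl

⋖⇒parts : ∀ {n} {μ ν : 𝒴 n} {i j} → μ ⋖[ i , j ] ν →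
          part μ i ≡ j × part ν i ≡ suc j × (∀ k → k ≢ i → part μ k ≡ part ν k)
⋖⇒parts {μ = μ} {ν} {i} {j} (□∉μ , cells) = μi≡j , νi≡1+j , λ k k≢i →
  ℕ.≤-antisym (≤-from-< λ l l<μk → from (k , l) (inj₁ l<μk)) (≤-from-< (other k≢i))
  where
  to : ∀ c → c ∈ ν → c ∈ μ ⊎ c ≡ (i , j)
  to c = Equivalence.to (cells c)
  from : ∀ c → c ∈ μ ⊎ c ≡ (i , j) → c ∈ ν
  from c = Equivalence.from (cells c)
  other : ∀ {k} → k ≢ i → ∀ l → l ℕ.< part ν k → l ℕ.< part μ k
  other {k} k≢i l l<νk with to (k , l) l<νk
  ... | inj₁ l<μk = l<μk
  ... | inj₂ eq   = contradiction (≡.cong proj₁ eq) k≢i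
  j<νi : j ℕ.< part ν i
  j<νi = from (i , j) (inj₂ ≡.refl)
  μi≤j : part μ i ℕ.≤ j
  μi≤j = ℕ.≮⇒≥ □∉μ
  μi≡j : part μ i ≡ j
  μi≡j with to (i , part μ i) (ℕ.≤-<-trans μi≤j j<νi)
  ... | inj₁ μi<μi = contradiction μi<μi (ℕ.<-irrefl ≡.refl)
  ... | inj₂ eq    = ≡.cong proj₂ eq
  νi≤1+j : part ν i ℕ.≤ suc j
  νi≤1+j = ≤-from-< λ l l<νi → case l (to (i , l) l<νi)
    where
    case : ∀ l → (i , l) ∈ μ ⊎ (i , l) ≡ (i , j) → l ℕ.< suc j
    case l (inj₁ l<μi)   = ℕ.<-trans (ℕ.<-≤-trans l<μi μi≤j) ℕ.≤-refl
    case l (inj₂ ≡.refl) = ℕ.≤-refl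
  νi≡1+j : part ν i ≡ suc j
  νi≡1+j = ℕ.≤-antisym νi≤1+j j<νi

parts⇒⋖ : ∀ {n} {μ ν : 𝒴 n} {i j} →
          part μ i ≡ j → part ν i ≡ suc j → (∀ k → k ≢ i → part μ k ≡ part ν k) → μ ⋖[ i , j ] ν
parts⇒⋖ {μ = μ} {ν} {i} {j} μi≡j νi≡1+j μ≡ν =
  (λ j<μi → ℕ.<-irrefl (≡.sym μi≡j) j<μi) , λ c → mk⇔ (to c) (from c)
  where
  to : ∀ c → c ∈ ν → c ∈ μ ⊎ c ≡ (i , j)
  to (k , l) l<νk with k Fin.≟ i
  ... | no k≢i = inj₁ (≡.subst (l ℕ.<_) (≡.sym (μ≡ν k k≢i)) l<νk)
  ... | yes ≡.refl with ℕ.m<1+n⇒m<n∨m≡n (≡.subst (l ℕ.<_) νi≡1+j l<νk)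
  ...   | inj₁ l<j    = inj₁ (≡.subst (l ℕ.<_) (≡.sym μi≡j) l<j)
  ...   | inj₂ ≡.refl = inj₂ ≡.refl
  from : ∀ c → c ∈ μ ⊎ c ≡ (i , j) → c ∈ ν
  from _ (inj₂ ≡.refl) = ≡.subst (j ℕ.<_) (≡.sym νi≡1+j) ℕ.≤-refl
  from (k , l) (inj₁ l<μk) with k Fin.≟ i
  ... | no k≢i     = ≡.subst (l ℕ.<_) (μ≡ν k k≢i) l<μk
  ... | yes ≡.refl = ≡.subst (l ℕ.<_) (≡.sym νi≡1+j) (ℕ.m<n⇒m<1+n (≡.subst (l ℕ.<_) μi≡j l<μk))

private
  decreasing? : ∀ {n} (f : Fin n → ℕ) → Dec (∀ i j → i Fin.≤ j → f j ℕ.≤ f i)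
  decreasing? f = Fin.all? λ i → Fin.all? λ j → i Fin.≤? j →-dec f j ℕ.≤? f i

  decreasing-≗ : ∀ {n} {f : Fin n → ℕ} (μ : 𝒴 n) → f ≗ part μ → ∀ i j → i Fin.≤ j → f j ℕ.≤ f i
  decreasing-≗ μ f≗μ i j i≤j = ≡.subst₂ ℕ._≤_ (≡.sym (f≗μ j)) (≡.sym (f≗μ i)) (decreasing μ i j i≤j)

  updateAt-≗ : ∀ {n} (μ ν : 𝒴 n) i {f} → f (part ν i) ≡ part μ i →
               (∀ k → k ≢ i → part μ k ≡ part ν k) → updateAt (part ν) i f ≗ part μ
  updateAt-≗ μ ν i fν≡μ μ≡ν k with k Fin.≟ i
  ... | yes ≡.refl = ≡.trans (updateAt-updates i (part ν)) fν≡μ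
  ... | no k≢i     = ≡.trans (updateAt-minimal k i (part ν) k≢i) (≡.sym (μ≡ν k k≢i))

removable? : ∀ {n} (ν : 𝒴 n) i → Dec (∃₂ λ j μ → μ ⋖[ i , j ] ν)
removable? {n} ν i = map′
  (λ (0<νi , dec) → let μ = lowered dec in ℕ.pred (part ν i) , μ , parts⇒⋖ {μ = μ} {ν}
    (updateAt-updates i (part ν)) (≡.sym (ℕ.suc-pred (part ν i) ⦃ ℕ.>-nonZero 0<νi ⦄))
    λ k → updateAt-minimal k i (part ν))
  (λ (j , μ , μ⋖ν) → let μi≡j , νi≡1+j , μ≡ν = ⋖⇒parts {μ = μ} {ν} μ⋖ν in
    ≡.subst (0 ℕ.<_) (≡.sym νi≡1+j) (s≤s z≤n) ,
    decreasing-≗ μ (updateAt-≗ μ ν i (≡.trans (≡.cong ℕ.pred νi≡1+j) (≡.sym μi≡j)) μ≡ν))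
  (0 ℕ.<? part ν i ×-dec decreasing? (updateAt (part ν) i ℕ.pred))
  where
  lowered : (∀ k l → k Fin.≤ l → updateAt (part ν) i ℕ.pred l ℕ.≤ updateAt (part ν) i ℕ.pred k) → 𝒴 n
  lowered dec = record { part = updateAt (part ν) i ℕ.pred ; decreasing = dec }

addable? : ∀ {n} (μ : 𝒴 n) i → Dec (∃₂ λ j ν → μ ⋖[ i , j ] ν)
addable? {n} μ i = map′
  (λ dec → let ν = raised dec in part μ i , ν , parts⇒⋖ {μ = μ} {ν} ≡.refl
    (updateAt-updates i (part μ)) λ k k≢i → ≡.sym (updateAt-minimal k i (part μ) k≢i))
  (λ (j , ν , μ⋖ν) → let μi≡j , νi≡1+j , μ≡ν = ⋖⇒parts {μ = μ} {ν} μ⋖ν in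
    decreasing-≗ ν (updateAt-≗ ν μ i (≡.trans (≡.cong suc μi≡j) (≡.sym νi≡1+j)) λ k k≢i → ≡.sym (μ≡ν k k≢i)))
  (decreasing? (updateAt (part μ) i suc))
  where
  raised : (∀ k l → k Fin.≤ l → updateAt (part μ) i suc l ℕ.≤ updateAt (part μ) i suc k) → 𝒴 n
  raised dec = record { part = updateAt (part μ) i suc ; decreasing = dec }

-- Sums of f □ μ over all μ with μ = ν - □, resp. μ = ν + □. By ⋖⇒parts each
-- row contains at most one such □, and □ determines μ, so the sum is over rows.
module _ {n : ℕ} (ν : 𝒴 n) (f : Cell n → 𝒴 n → Λ n) where
  open CommutativeRing (symmetricRing n) using (0#; +-commutativeMonoid)
  open MonoidSum +-commutativeMonoid using (sum-syntax)

  rowTerm : ∀ i {P : ℕ → 𝒴 n → Set} → Dec (∃₂ P) → Λ n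
  rowTerm i (yes (j , μ , _)) = f (i , j) μ
  rowTerm i (no _)            = 0#

  ∑-remove ∑-add : Λ n
  ∑-remove = ∑[ i < n ] rowTerm i (removable? ν i)
  ∑-add    = ∑[ i < n ] rowTerm i (addable? ν i)

module _ {n : ℕ} where
  open CommutativeRing (polynomialRing n) using (_*_; _≈_; *-rawMagma)
  open RawMagmaDefinitions *-rawMagma using (module _∣ʳ_)
  open Determinant (polynomialRing n) using (staircase∣alternant)

  infixl 6 _+δ
  _+δ : 𝒴 n → Fin n → ℕ
  (ν +δ) i = part ν i ℕ.+ δ i

  opaque
    -- The quotient exists by staircase∣alternant and is unique by a-δ-cancel.
    schurPolynomial : 𝒴 n → Poly n
    schurPolynomial ν = _∣ʳ_.quotient (staircase∣alternant var (ν +δ))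

    schurPolynomial-quotient : ∀ ν → schurPolynomial ν * a δ ≈ a (ν +δ)
    schurPolynomial-quotient ν = _∣ʳ_.equality (staircase∣alternant var (ν +δ))

  schur : 𝒴 n → Λ n
  schur ν = mkΛ (schurPolynomial ν) (quotient-symmetric _ (ν +δ) (schurPolynomial-quotient ν))

{-# OPTIONS --safe #-}
module Submission where

-- A derivation applied to a determinant is the sum over columns of the determinants with that column
-- differentiated, so Σᵢ xᵢᵉ ∂ᵢ sends a_μ to Σ_c μ_c a_{μ + (e-1) ε_c}. Applying it to s_λ a_δ = a_{λ+δ}
-- gives D(s_λ) a_δ = D(a_{λ+δ}) - s_λ D(a_δ). A term whose shifted exponent is not μ + δ for a partition μ
-- has two equal adjacent columns or coefficient 0. For e = 2 the correction is (n-1) s_λ a_{δ+ε₁}, which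
-- equals (n-1) (x₁ + ⋯ + xₙ) a_{λ+δ} = (n-1) Σ_c a_{λ+δ+ε_c}: it turns λ_c + n - c into a content.

open import Defs
open import Algebra.Bundles using (CommutativeRing)
import Algebra.Properties.CommutativeMonoid.Sum as MonoidSum
import Algebra.Properties.Ring as RingProperties
import Algebra.Properties.Semiring.Exp as Exp
import Algebra.Properties.Semiring.Sum as SemiringSum
import Algebra.Solver.Ring.NaturalCoefficients.Default as Solver
open import Data.Fin.Base as Fin using (Fin; zero; suc; toℕ; punchIn; punchOut; inject₁; fromℕ)
open import Data.Fin.Properties as Fin using (punchIn-punchOut; punchIn-injective; punchInᵢ≢i)
open import Data.Fin.Relation.Unary.Top using (view; ‵fromℕ; ‵inject₁)
open import Data.Integer.Base as ℤ using (+_)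
import Data.Integer.Properties as ℤ
open import Data.Integer.Solver using (module +-*-Solver)
open import Data.Nat.Base as ℕ using (ℕ; zero; suc; _∸_; _≤_; z≤n)
import Data.Nat.Properties as ℕ
open import Data.Product.Base using (_×_; _,_; ∃-syntax; ∃₂)
import Data.Rational.Base as ℚ
open import Data.Rational.Literals using (fromℤ)
import Data.Rational.Properties as ℚ
import Data.Rational.Unnormalised.Base as ℚᵘ
import Data.Rational.Unnormalised.Properties as ℚᵘ
open import Data.Vec.Functional using (updateAt)
open import Data.Vec.Functional.Properties using (updateAt-updates; updateAt-minimal; updateAt-id)
open import Function.Base using (_∘_; const)
open import Level using (_⊔_)
open import Relation.Binary.PropositionalEquality as ≡ using (_≡_; _≢_; _≗_)
open import Relation.Nullary.Decidable using (Dec; yes; no; dec-true; dec-false)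
open import Relation.Nullary.Negation using (¬_; contradiction)

private
  module NatSum = MonoidSum ℕ.+-0-commutativeMonoid

-- Determinants under derivations and column operations.

module ColumnReplacement {c ℓ} (R : CommutativeRing c ℓ) where
  open CommutativeRing R hiding (zero)
  open RingProperties ring using (x+x≈x⇒x≈0)
  open MonoidSum +-commutativeMonoid using (sum; sum-cong-≋; sum-remove; sum-syntax)
  open SemiringSum semiring using (*-distribˡ-sum)
  open Exp semiring using (_^_)
  open Determinant R
  open Solver commutativeSemiring using (solve; _:+_; _:*_; _:=_; con)
  open import Relation.Binary.Reasoning.Setoid setoid

  record IsDerivation (D : Carrier → Carrier) : Set (c ⊔ ℓ) where
    field
      cong    : ∀ {x y} → x ≈ y → D x ≈ D y
      +-homo  : ∀ x y → D (x + y) ≈ D x + D y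
      leibniz : ∀ x y → D (x * y) ≈ D x * y + x * D y

    0-const : D 0# ≈ 0#
    0-const = x+x≈x⇒x≈0 _ (trans (sym (+-homo 0# 0#)) (cong (+-identityˡ 0#)))

    1-const : D 1# ≈ 0#
    1-const = x+x≈x⇒x≈0 _ (begin
      D 1# + D 1#              ≈⟨ solve 1 (λ d → d :+ d := d :* con 1 :+ con 1 :* d) refl (D 1#) ⟩
      D 1# * 1# + 1# * D 1#    ≈⟨ leibniz 1# 1# ⟨
      D (1# * 1#)              ≈⟨ cong (*-identityˡ 1#) ⟩
      D 1#                     ∎)

    -1-const : D (- 1#) ≈ 0#
    -1-const = begin
      D (- 1#)           ≈⟨ +-identityˡ _ ⟨
      0# + D (- 1#)      ≈⟨ +-congʳ 1-const ⟨
      D 1# + D (- 1#)    ≈⟨ +-homo 1# (- 1#) ⟨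
      D (1# - 1#)        ≈⟨ cong (-‿inverseʳ 1#) ⟩
      D 0#               ≈⟨ 0-const ⟩
      0#                 ∎

    -- `alternatingSum` is opaque, so the induction peels off one term at a time with `alt-suc`; the
    -- sign passes through `D` because `D (- 1#)` vanishes.
    alternatingSum-homo : ∀ {n} (f : Fin n → Carrier) → D (alternatingSum f) ≈ alternatingSum (D ∘ f)
    alternatingSum-homo {zero}  f = trans (cong (alt-empty f)) (trans 0-const (sym (alt-empty _)))
    alternatingSum-homo {suc n} f = begin
      D (alternatingSum f)                      ≈⟨ cong (alt-suc f) ⟩
      D (f zero + - 1# * A)                     ≈⟨ trans (+-homo _ _) (+-congˡ (leibniz _ _)) ⟩
      D (f zero) + (D (- 1#) * A + - 1# * D A)  ≈⟨ +-congˡ (+-cong (*-congʳ -1-const) (*-congˡ (alternatingSum-homo (f ∘ suc)))) ⟩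
      D (f zero) + (0# * A + - 1# * A′)         ≈⟨ solve 4 (λ x a s b → x :+ (con 0 :* a :+ s :* b) := x :+ s :* b) refl (D (f zero)) A (- 1#) A′ ⟩
      D (f zero) + - 1# * A′                    ≈⟨ alt-suc (D ∘ f) ⟨
      alternatingSum (D ∘ f)                    ∎
      where
      A  = alternatingSum (f ∘ suc)
      A′ = alternatingSum (D ∘ f ∘ suc)

  private
    1-linear : ∀ x y → x + 1# * y ≈ x + y
    1-linear x y = +-congˡ (*-identityˡ y)

  alternatingSum-+ : ∀ {n} (f g : Fin n → Carrier) →
                     alternatingSum (λ j → f j + g j) ≈ alternatingSum f + alternatingSum g
  alternatingSum-+ f g = begin
    alternatingSum (λ j → f j + g j)          ≈⟨ alt-cong (λ j → 1-linear (f j) (g j)) ⟨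
    alternatingSum (λ j → f j + 1# * g j)     ≈⟨ alt-linear 1# f g ⟩
    alternatingSum f + 1# * alternatingSum g  ≈⟨ 1-linear _ _ ⟩
    alternatingSum f + alternatingSum g       ∎

  alternatingSum-0 : ∀ {n} {f : Fin n → Carrier} → (∀ j → f j ≈ 0#) → alternatingSum f ≈ 0#
  alternatingSum-0 {f = f} f≈0 = begin
    alternatingSum f                 ≈⟨ alt-cong (λ j → trans (f≈0 j) (sym (zeroˡ _))) ⟩
    alternatingSum (λ j → 0# * f j)  ≈⟨ alt-scale 0# f ⟩
    0# * alternatingSum f            ≈⟨ zeroˡ _ ⟩
    0#                               ∎

  sum-alternatingSum-comm : ∀ {m n} (f : Fin m → Fin n → Carrier) →
    sum (λ i → alternatingSum (f i)) ≈ alternatingSum λ j → sum λ i → f i j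
  sum-alternatingSum-comm {zero}  f = sym (alternatingSum-0 λ _ → refl)
  sum-alternatingSum-comm {suc m} f =
    trans (+-congˡ (sum-alternatingSum-comm (f ∘ suc))) (sym (alternatingSum-+ (f zero) _))

  minor : ∀ {n} → Matrix (suc n) → Fin (suc n) → Matrix n
  minor M j i k = M (suc i) (punchIn j k)

  replaceColumn : ∀ {n} → Matrix n → Matrix n → Fin n → Matrix n
  replaceColumn M N c i = updateAt (M i) c (const (N i c))

  -- The directional derivative of `det` at `M` along `N`.
  columnwise : ∀ {n} → Matrix n → Matrix n → Carrier
  columnwise M N = sum λ c → det (replaceColumn M N c)

  private
    updateAt-punchIn : ∀ {n} (u : Fin (suc n) → Carrier) (f : Carrier → Carrier) j k →
      updateAt u (punchIn j k) f ∘ punchIn j ≗ updateAt (u ∘ punchIn j) k f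
    updateAt-punchIn u f j k l with l Fin.≟ k
    ... | yes ≡.refl = ≡.trans (updateAt-updates (punchIn j l) u) (≡.sym (updateAt-updates l (u ∘ punchIn j)))
    ... | no l≢k     = ≡.trans (updateAt-minimal (punchIn j l) (punchIn j k) u (l≢k ∘ punchIn-injective j l k))
                               (≡.sym (updateAt-minimal l k (u ∘ punchIn j) l≢k))

  -- Expand along row `zero` and collect by pivot `j`: the replaced column is either the pivot
  -- column, which changes only the entry, or a column of the minor, which changes only the minor.
  -- The result is a product-rule recursion.
  columnwise-expand : ∀ {n} (M N : Matrix (suc n)) →
    columnwise M N ≈ alternatingSum λ j → N zero j * det (minor M j) + M zero j * columnwise (minor M j) (minor N j)
  columnwise-expand {n} M N = trans (sum-alternatingSum-comm λ c j → t j c) (alt-cong λ j → begin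
    sum (t j)                                              ≈⟨ sum-remove {i = j} (t j) ⟩
    t j j + sum (t j ∘ punchIn j)                          ≈⟨ +-cong (replaced j) (sum-cong-≋ (other j)) ⟩
    N zero j * det (minor M j) + ∑[ k < n ] (M zero j * det (replaceColumn (minor M j) (minor N j) k))
      ≈⟨ +-congˡ (*-distribˡ-sum (M zero j) (λ k → det (replaceColumn (minor M j) (minor N j) k))) ⟨
    N zero j * det (minor M j) + M zero j * columnwise (minor M j) (minor N j) ∎)
    where
    t : Fin (suc n) → Fin (suc n) → Carrier
    t j c = replaceColumn M N c zero j * det (minor (replaceColumn M N c) j)
    replaced : ∀ j → t j j ≈ N zero j * det (minor M j)
    replaced j = *-cong (reflexive (updateAt-updates j (M zero)))
      (det-cong λ i k → reflexive (updateAt-minimal (punchIn j k) j (M (suc i)) (punchInᵢ≢i j k)))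
    other : ∀ j k → t j (punchIn j k) ≈ M zero j * det (replaceColumn (minor M j) (minor N j) k)
    other j k = *-cong (reflexive (updateAt-minimal j (punchIn j k) (M zero) (punchInᵢ≢i j k ∘ ≡.sym)))
      (det-cong λ i l → reflexive (updateAt-punchIn (M (suc i)) (const (N (suc i) (punchIn j k))) j k l))

  -- The Leibniz rule on each term of the row expansion, with induction on the minors, reproduces
  -- the recursion of `columnwise-expand`.
  derivation-det : ∀ {D} → IsDerivation D → ∀ {n} (M : Matrix n) → D (det M) ≈ columnwise M λ i j → D (M i j)
  derivation-det D-der {zero}      M = IsDerivation.1-const D-der
  derivation-det {D} D-der {suc n} M = begin
    D (det M)
      ≈⟨ alternatingSum-homo _ ⟩
    alternatingSum (λ j → D (M zero j * det (minor M j)))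
      ≈⟨ alt-cong (λ j → trans (leibniz _ _) (+-congˡ (*-congˡ (derivation-det D-der (minor M j))))) ⟩
    alternatingSum (λ j → D (M zero j) * det (minor M j) + M zero j * columnwise (minor M j) (minor DM j))
      ≈⟨ columnwise-expand M DM ⟨
    columnwise M DM ∎
    where
    open IsDerivation D-der
    DM : Matrix (suc n)
    DM i j = D (M i j)

  -- Both sides are the derivative at t = 0 of the determinant of `M` with each row i multiplied by
  -- 1 + t `x i`, taken by rows on the left and by columns on the right. In the recursion `x zero`
  -- goes to the pivot entry and the rest of the sum to the minor.
  sum-*-det : ∀ {n} (x : Fin n → Carrier) (M : Matrix n) → sum x * det M ≈ columnwise M λ i j → x i * M i j
  sum-*-det {zero}  x M = zeroˡ _
  sum-*-det {suc n} x M = begin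
    sum x * det M
      ≈⟨ alt-scale (sum x) _ ⟨
    alternatingSum (λ j → sum x * (M zero j * det (minor M j)))
      ≈⟨ alt-cong (λ j → trans
           (solve 4 (λ a b m d → (a :+ b) :* (m :* d) := a :* m :* d :+ m :* (b :* d)) refl (x zero) (sum (x ∘ suc)) (M zero j) (det (minor M j)))
           (+-congˡ (*-congˡ (sum-*-det (x ∘ suc) (minor M j))))) ⟩
    alternatingSum (λ j → x zero * M zero j * det (minor M j) + M zero j * columnwise (minor M j) (minor xM j))
      ≈⟨ columnwise-expand M xM ⟨
    columnwise M xM ∎
    where
    xM : Matrix (suc n)
    xM i j = x i * M i j

  -- `det` expands along rows, so the scaled column appears either as the pivot entry or inside the
  -- minor, where `punchOut` locates it for the induction.
  det-scale-column : ∀ {n} (c : Fin n) b {A B : Matrix n} → (∀ i → B i c ≈ b * A i c) →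
                     (∀ i j → j ≢ c → B i j ≈ A i j) → det B ≈ b * det A
  det-scale-column {suc n} c b {A} {B} Bc≈bAc B≈A = trans (alt-cong term) (alt-scale b _)
    where
    term : ∀ j → B zero j * det (minor B j) ≈ b * (A zero j * det (minor A j))
    term j with j Fin.≟ c
    ... | yes ≡.refl = trans
      (*-cong (Bc≈bAc zero) (det-cong λ i k → B≈A (suc i) (punchIn j k) (punchInᵢ≢i j k))) (*-assoc _ _ _)
    ... | no j≢c = trans
      (*-cong (B≈A zero j j≢c) (det-scale-column c′ b {minor A j} {minor B j}
        (λ i → ≡.subst (λ k → B (suc i) k ≈ b * A (suc i) k) (≡.sym c′≡c) (Bc≈bAc (suc i)))
        (λ i k k≢c′ → B≈A (suc i) (punchIn j k) (k≢c′ ∘ λ eq → punchIn-injective j k c′ (≡.trans eq (≡.sym c′≡c))))))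
      (solve 3 (λ m b d → m :* (b :* d) := b :* (m :* d)) refl (A zero j) b (det (minor A j)))
      where
      c′ = punchOut j≢c
      c′≡c : punchIn j c′ ≡ c
      c′≡c = punchIn-punchOut j≢c

  -- Neighbouring positions carry opposite signs, so the two surviving terms cancel.
  alternatingSum-adjacent : ∀ {n} (k : Fin n) {f : Fin (suc n) → Carrier} → f (inject₁ k) ≈ f (suc k) →
    (∀ j → j ≢ inject₁ k → j ≢ suc k → f j ≈ 0#) → alternatingSum f ≈ 0#
  alternatingSum-adjacent zero {f} f₀≈f₁ f≈0 = begin
    alternatingSum f                                       ≈⟨ trans (alt-suc f) (+-congˡ (*-congˡ (alt-suc (f ∘ suc)))) ⟩
    f zero + - 1# * (f (suc zero) + - 1# * alternatingSum (λ j → f (suc (suc j))))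
      ≈⟨ +-cong f₀≈f₁ (*-congˡ (+-congˡ (*-congˡ (alternatingSum-0 λ j → f≈0 (suc (suc j)) (λ ()) (λ ()))))) ⟩
    f (suc zero) + - 1# * (f (suc zero) + - 1# * 0#)       ≈⟨ solve 2 (λ a s → a :+ s :* (a :+ s :* con 0) := (con 1 :+ s) :* a) refl (f (suc zero)) (- 1#) ⟩
    (1# - 1#) * f (suc zero)                               ≈⟨ trans (*-congʳ (-‿inverseʳ 1#)) (zeroˡ _) ⟩
    0#                                                     ∎
  alternatingSum-adjacent (suc k) {f} fk≈fk+1 f≈0 = begin
    alternatingSum f                          ≈⟨ alt-suc f ⟩
    f zero + - 1# * alternatingSum (f ∘ suc)  ≈⟨ +-cong (f≈0 zero (λ ()) (λ ()))
      (*-congˡ (alternatingSum-adjacent k fk≈fk+1 λ j j≢k j≢k+1 → f≈0 (suc j) (j≢k ∘ Fin.suc-injective) (j≢k+1 ∘ Fin.suc-injective))) ⟩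
    0# + - 1# * 0#                            ≈⟨ trans (+-identityˡ _) (zeroʳ _) ⟩
    0#                                        ∎

  private
    punchIn-adjacent : ∀ {n} (k : Fin n) (u : Fin (suc n) → Carrier) → u (inject₁ k) ≈ u (suc k) →
                       ∀ l → u (punchIn (inject₁ k) l) ≈ u (punchIn (suc k) l)
    punchIn-adjacent zero    u eq zero    = sym eq
    punchIn-adjacent zero    u eq (suc l) = refl
    punchIn-adjacent (suc k) u eq zero    = refl
    punchIn-adjacent (suc k) u eq (suc l) = punchIn-adjacent k (u ∘ suc) eq l

    adjacent-preimage : ∀ {n} (k : Fin (suc n)) j → j ≢ inject₁ k → j ≢ suc k →
      ∃[ k′ ] punchIn j (inject₁ k′) ≡ inject₁ k × punchIn j (suc k′) ≡ suc k
    adjacent-preimage zero    zero          j≢k j≢k+1 = contradiction ≡.refl j≢k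
    adjacent-preimage zero    (suc zero)    j≢k j≢k+1 = contradiction ≡.refl j≢k+1
    adjacent-preimage {suc n} zero (suc (suc j)) j≢k j≢k+1 = zero , ≡.refl , ≡.refl
    adjacent-preimage (suc k) zero          j≢k j≢k+1 = k , ≡.refl , ≡.refl
    adjacent-preimage {suc n} (suc k) (suc j) j≢k j≢k+1 =
      let k′ , p , q = adjacent-preimage k j (j≢k ∘ ≡.cong suc) (j≢k+1 ∘ ≡.cong suc)
      in suc k′ , ≡.cong suc p , ≡.cong suc q

  -- The minors of the two equal columns coincide and enter with opposite signs, while every other
  -- minor still contains both columns side by side and vanishes by induction.
  det-adjacent-columns : ∀ {n} (k : Fin n) (M : Matrix (suc n)) → (∀ i → M i (inject₁ k) ≈ M i (suc k)) → det M ≈ 0#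
  det-adjacent-columns {suc n} k M eq = alternatingSum-adjacent k
    (*-cong (eq zero) (det-cong λ i → punchIn-adjacent k (M (suc i)) (eq (suc i))))
    λ j j≢k j≢k+1 → let k′ , p , q = adjacent-preimage k j j≢k j≢k+1 in
      trans (*-congˡ (det-adjacent-columns k′ (minor M j) λ i →
        ≡.subst₂ (λ l l′ → M (suc i) l ≈ M (suc i) l′) (≡.sym p) (≡.sym q) (eq (suc i)))) (zeroʳ _)

  -- Alternants with one exponent changed.

  powers : ∀ {n} → (Fin n → Carrier) → (Fin n → ℕ) → Matrix n
  powers x μ i j = x i ^ μ j

  alternant-cong : ∀ {n} (x : Fin n → Carrier) {μ ρ : Fin n → ℕ} → μ ≗ ρ → alternant x μ ≈ alternant x ρ
  alternant-cong x μ≗ρ = det-cong λ i j → reflexive (≡.cong (x i ^_) (μ≗ρ j))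

  alternant-adjacent : ∀ {n} (x : Fin (suc n) → Carrier) μ (k : Fin n) → μ (inject₁ k) ≡ μ (suc k) → alternant x μ ≈ 0#
  alternant-adjacent x μ k eq = det-adjacent-columns k (powers x μ) λ i → reflexive (≡.cong (x i ^_) eq)

  private
    inject₁≢suc : ∀ {n} (k : Fin n) → inject₁ k ≢ suc k
    inject₁≢suc k eq = ℕ.1+n≢n (≡.trans (≡.cong toℕ (≡.sym eq)) (Fin.toℕ-inject₁ k))

  -- Neighbouring exponents m + 1 and m collide once the smaller is raised.
  alternant-raise-adjacent : ∀ {n} (x : Fin (suc n) → Carrier) μ (k : Fin n) → μ (inject₁ k) ≡ suc (μ (suc k)) →
                             alternant x (updateAt μ (suc k) suc) ≈ 0#
  alternant-raise-adjacent x μ k eq = alternant-adjacent x (updateAt μ (suc k) suc) k (≡.trans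
    (updateAt-minimal (inject₁ k) (suc k) μ (inject₁≢suc k)) (≡.trans eq (≡.sym (updateAt-updates (suc k) μ))))

  -- The same collision, reached by lowering the larger exponent.
  alternant-lower-adjacent : ∀ {n} (x : Fin (suc n) → Carrier) μ (k : Fin n) → μ (inject₁ k) ≡ suc (μ (suc k)) →
                             alternant x (updateAt μ (inject₁ k) ℕ.pred) ≈ 0#
  alternant-lower-adjacent x μ k eq = alternant-adjacent x (updateAt μ (inject₁ k) ℕ.pred) k (≡.trans
    (updateAt-updates (inject₁ k) μ) (≡.trans (≡.cong ℕ.pred eq)
      (≡.sym (updateAt-minimal (suc k) (inject₁ k) μ (inject₁≢suc k ∘ ≡.sym)))))

  -- `b` and `g` describe an operator sending x^m to `b m` times x^(`g m`). On a single column it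
  -- changes one exponent and pulls out a scalar, so the result is again a combination of
  -- alternants.
  columnwise-alternant : ∀ {n} (x : Fin n → Carrier) (b : ℕ → Carrier) (g : ℕ → ℕ) (μ : Fin n → ℕ) (N : Matrix n) →
    (∀ i j → N i j ≈ b (μ j) * x i ^ g (μ j)) →
    columnwise (powers x μ) N ≈ sum λ c → b (μ c) * alternant x (updateAt μ c g)
  columnwise-alternant x b g μ N N≈ = sum-cong-≋ λ c → det-scale-column c (b (μ c))
    (λ i → trans (reflexive (updateAt-updates c (λ j → x i ^ μ j))) (trans (N≈ i c)
      (*-congˡ (reflexive (≡.cong (x i ^_) (≡.sym (updateAt-updates c μ)))))))
    (λ i j j≢c → reflexive (≡.trans (updateAt-minimal j c (λ j → x i ^ μ j) j≢c)
      (≡.cong (x i ^_) (≡.sym (updateAt-minimal j c μ j≢c)))))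

  derivation-alternant : ∀ {D} → IsDerivation D → ∀ {n} (x : Fin n → Carrier) b g →
    (∀ i m → D (x i ^ m) ≈ b m * x i ^ g m) → ∀ μ →
    D (alternant x μ) ≈ sum λ c → b (μ c) * alternant x (updateAt μ c g)
  derivation-alternant D-der x b g power μ =
    trans (derivation-det D-der (powers x μ)) (columnwise-alternant x b g μ _ λ i j → power i (μ j))

  -- Pieri's rule for the first elementary symmetric polynomial: multiplying the entries of column c
  -- by their variables raises its exponent by one, and `sum-*-det` sums over c.
  pieri : ∀ {n} (x : Fin n → Carrier) μ → sum x * alternant x μ ≈ sum λ c → alternant x (updateAt μ c suc)
  pieri x μ = trans (sum-*-det x (powers x μ))
    (trans (columnwise-alternant x (const 1#) suc μ _ λ i j → sym (*-identityˡ _))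
           (sum-cong-≋ λ c → *-identityˡ (alternant x (updateAt μ c suc))))

-- Derivations of the polynomial ring.

fromℤ-+ : ∀ i j → fromℤ (i ℤ.+ j) ≡ fromℤ i ℚ.+ fromℤ j
-- Addition in ℚ normalises its result, so the comparison is made between unnormalised fractions by
-- cross-multiplication.
fromℤ-+ i j = ℚ.toℚᵘ-injective (ℚᵘ.≃-trans
  (ℚᵘ.*≡* (solve 2 (λ i j → (i :+ j) :* con (+ 1) := (i :* con (+ 1) :+ j :* con (+ 1)) :* con (+ 1)) ≡.refl i j))
  (ℚᵘ.≃-sym (ℚ.toℚᵘ-homo-+ (fromℤ i) (fromℤ j))))
  where open +-*-Solver

fromℤ-* : ∀ i j → fromℤ (i ℤ.* j) ≡ fromℤ i ℚ.* fromℤ j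
fromℤ-* i j = ℚ.toℚᵘ-injective (ℚᵘ.≃-sym (ℚ.toℚᵘ-homo-* (fromℤ i) (fromℤ j)))

module _ {n : ℕ} where
  open CommutativeRing (polynomialRing n) hiding (zero)
  open MonoidSum +-commutativeMonoid using (sum; sum-cong-≋; ∑-distrib-+; sum-syntax)
  open SemiringSum semiring using (*-distribˡ-sum; *-distribʳ-sum)
  open Exp semiring using (_^_)
  open ColumnReplacement (polynomialRing n)
  open Solver commutativeSemiring using (solve; _:+_; _:*_; _:=_) renaming (con to κ)
  open import Relation.Binary.Reasoning.Setoid setoid

  ι : ℕ → Poly n
  ι m = con (fromℤ (+ m))

  con-fromℤ-+ : ∀ i j → con (fromℤ (i ℤ.+ j)) ≈ con (fromℤ i) + con (fromℤ j)
  con-fromℤ-+ i j = trans (reflexive (≡.cong con (fromℤ-+ i j))) (con-⊕ (fromℤ i) (fromℤ j))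

  con-fromℤ-* : ∀ i j → con (fromℤ (i ℤ.* j)) ≈ con (fromℤ i) * con (fromℤ j)
  con-fromℤ-* i j = trans (reflexive (≡.cong con (fromℤ-* i j))) (con-⊗ (fromℤ i) (fromℤ j))

  ι-sum : ∀ {m} (f : Fin m → ℕ) → ι (NatSum.sum f) ≈ sum (ι ∘ f)
  ι-sum {zero}  f = refl
  ι-sum {suc m} f = trans (con-fromℤ-+ (+ f zero) _) (+-congˡ (ι-sum (f ∘ suc)))

  -- The choices `const 1#`, `var` and `λ i → var i ^ 2` for `v` give `d₋`, `d₀` and `d₊` up to the
  -- scalar factors -1, 2 and 1.
  vectorField : (Fin n → Poly n) → Poly n → Poly n
  vectorField v p = ∑[ i < n ] (v i * ∂ i p)

  vectorField-isDerivation : ∀ v → IsDerivation (vectorField v)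
  vectorField-isDerivation v = record
    { cong    = λ p≈q → sum-cong-≋ λ i → *-congˡ (∂-cong i p≈q)
    ; +-homo  = λ p q → trans (sum-cong-≋ λ i → distribˡ (v i) (∂ i p) (∂ i q)) (∑-distrib-+ (λ i → v i * ∂ i p) _)
    ; leibniz = λ p q → begin
        ∑[ i < n ] (v i * (∂ i p * q + p * ∂ i q))
          ≈⟨ sum-cong-≋ (λ i → solve 5 (λ v p p′ q q′ → v :* (p′ :* q :+ p :* q′) := v :* p′ :* q :+ p :* (v :* q′)) refl (v i) p (∂ i p) q (∂ i q)) ⟩
        ∑[ i < n ] (v i * ∂ i p * q + p * (v i * ∂ i q))
          ≈⟨ ∑-distrib-+ (λ i → v i * ∂ i p * q) (λ i → p * (v i * ∂ i q)) ⟩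
        ∑[ i < n ] (v i * ∂ i p * q) + ∑[ i < n ] (p * (v i * ∂ i q))
          ≈⟨ +-cong (*-distribʳ-sum q (λ i → v i * ∂ i p)) (*-distribˡ-sum p (λ i → v i * ∂ i q)) ⟨
        vectorField v p * q + p * vectorField v q ∎
    }

  -- Stated at exponent `suc m`, which keeps truncated subtraction out of the formula.
  power-rule : ∀ {D} → IsDerivation D → ∀ p m → D (p ^ suc m) ≈ ι (suc m) * (D p * p ^ m)
  power-rule {D} D-der p zero = begin
    D (p * 1#)               ≈⟨ trans (leibniz p 1#) (+-congˡ (*-congˡ 1-const)) ⟩
    D p * 1# + p * 0#        ≈⟨ solve 2 (λ p p′ → p′ :* κ 1 :+ p :* κ 0 := κ 1 :* (p′ :* κ 1)) refl p (D p) ⟩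
    -- `1#` is `ι 1` by computation.
    1# * (D p * 1#)          ∎
    where open IsDerivation D-der
  power-rule {D} D-der p (suc m) = begin
    D (p * p ^ suc m)                               ≈⟨ trans (leibniz p _) (+-congˡ (*-congˡ (power-rule D-der p m))) ⟩
    D p * (p * p ^ m) + p * (ι (suc m) * (D p * p ^ m))
      ≈⟨ solve 4 (λ p p′ q k → p′ :* (p :* q) :+ p :* (k :* (p′ :* q)) := (κ 1 :+ k) :* (p′ :* (p :* q))) refl p (D p) (p ^ m) (ι (suc m)) ⟩
    (1# + ι (suc m)) * (D p * (p * p ^ m))          ≈⟨ *-congʳ (con-fromℤ-+ (+ 1) (+ suc m)) ⟨
    ι (suc (suc m)) * (D p * p ^ suc m)             ∎
    where open IsDerivation D-der

∂-self : ∀ {n} (i : Fin n) → ∂ i (var i) ≡ con ℚ.1ℚ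
∂-self i rewrite dec-true (i Fin.≟ i) ≡.refl = ≡.refl

∂-other : ∀ {n} (i j : Fin n) → i ≢ j → ∂ i (var j) ≡ con ℚ.0ℚ
∂-other i j i≢j rewrite dec-false (i Fin.≟ j) i≢j = ≡.refl

vectorField-var : ∀ {n} (v : Fin n → Poly n) j → vectorField v (var j) ≋ v j
vectorField-var {suc n} v j = begin
  vectorField v (var j)                                  ≈⟨ sum-remove {i = j} (λ i → v i * ∂ i (var j)) ⟩
  v j * ∂ j (var j) + ∑[ k < n ] (v (punchIn j k) * ∂ (punchIn j k) (var j))
    ≈⟨ +-cong (trans (*-congˡ (reflexive (∂-self j))) (*-identityʳ _))
         (trans (sum-cong-≋ λ k → trans (*-congˡ (reflexive (∂-other _ j (punchInᵢ≢i j k)))) (zeroʳ _)) (sum-replicate-zero n)) ⟩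
  v j + 0#                                               ≈⟨ +-identityʳ _ ⟩
  v j                                                    ∎
  where
  open CommutativeRing (polynomialRing (suc n)) hiding (zero)
  open MonoidSum +-commutativeMonoid using (sum-cong-≋; sum-remove; sum-replicate-zero; sum-syntax)
  open import Relation.Binary.Reasoning.Setoid setoid

-- Staircase exponents and derivatives of polynomial alternants.

δ-step : ∀ {m} (k : Fin m) → δ (inject₁ k) ≡ suc (δ (suc k))
δ-step {m} k = ≡.trans (≡.cong (m ∸_) (Fin.toℕ-inject₁ k)) (ℕ.+-∸-assoc 1 (Fin.toℕ<n k))

δ-last : ∀ m → δ (fromℕ m) ≡ 0
δ-last m = ≡.trans (≡.cong (m ∸_) (Fin.toℕ-fromℕ m)) (ℕ.n∸n≡0 m)

-- A gap of exactly one is what makes two columns equal after one of the exponents is raised or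
-- lowered.
+δ-step : ∀ {m} (ν : 𝒴 (suc m)) k → part ν (inject₁ k) ≡ part ν (suc k) → (ν +δ) (inject₁ k) ≡ suc ((ν +δ) (suc k))
+δ-step ν k eq = ≡.trans (≡.cong₂ ℕ._+_ eq (δ-step k)) (ℕ.+-suc _ _)

module _ {n : ℕ} where
  open CommutativeRing (polynomialRing n) hiding (zero)
  open MonoidSum +-commutativeMonoid using (sum)
  open Exp semiring using (_^_)
  open ColumnReplacement (polynomialRing n)

  -- `g` is constrained only at positive exponents, because `ι zero` kills the term of a constant
  -- power; so `ℕ.pred`, with its value `zero` at `zero`, can serve for `v = const 1#`.
  vectorField-alternant : ∀ (v : Fin n → Poly n) (g : ℕ → ℕ) →
    (∀ i m → v i * var i ^ m ≈ var i ^ g (suc m)) → ∀ μ →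
    vectorField v (a μ) ≈ sum λ c → ι (μ c) * a (updateAt μ c g)
  vectorField-alternant v g v-power = derivation-alternant v-der var ι g power
    where
    v-der : IsDerivation (vectorField v)
    v-der = vectorField-isDerivation v
    power : ∀ i m → vectorField v (var i ^ m) ≈ ι m * var i ^ g m
    power i zero    = trans (IsDerivation.1-const v-der) (sym (zeroˡ _))
    power i (suc m) = trans (power-rule v-der (var i) m)
      (*-congˡ (trans (*-congʳ (vectorField-var v i)) (v-power i m)))

-- Removable and addable corners of a diagram.

lowered : ∀ {n} (ν : 𝒴 n) i → 0 ℕ.< part ν i → (∀ j → i Fin.< j → part ν j ℕ.< part ν i) → ∃₂ λ j μ → μ ⋖[ i , j ] ν
lowered ν i 0<νi corner = ℕ.pred (part ν i) , μ , parts⇒⋖ {μ = μ} {ν} at-i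
  (≡.sym (ℕ.suc-pred (part ν i) ⦃ ℕ.>-nonZero 0<νi ⦄)) off-i
  where
  f = updateAt (part ν) i ℕ.pred
  at-i : f i ≡ ℕ.pred (part ν i)
  at-i = updateAt-updates i (part ν)
  off-i : ∀ k → k ≢ i → f k ≡ part ν k
  off-i k = updateAt-minimal k i (part ν)
  f≤ν : ∀ k → f k ≤ part ν k
  f≤ν k with k Fin.≟ i
  ... | yes ≡.refl = ℕ.≤-trans (ℕ.≤-reflexive at-i) ℕ.pred[n]≤n
  ... | no k≢i     = ℕ.≤-reflexive (off-i k k≢i)
  f-decreasing : ∀ k l → k Fin.≤ l → f l ≤ f k
  f-decreasing k l k≤l with k Fin.≟ i
  ... | no k≢i = ℕ.≤-trans (f≤ν l) (ℕ.≤-trans (decreasing ν k l k≤l) (ℕ.≤-reflexive (≡.sym (off-i k k≢i))))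
  ... | yes ≡.refl with l Fin.≟ k
  ...   | yes ≡.refl = ℕ.≤-refl
  ...   | no l≢k     = ℕ.≤-trans (f≤ν l) (ℕ.≤-trans
    (ℕ.<⇒≤pred (corner l (Fin.≤∧≢⇒< k≤l (l≢k ∘ ≡.sym)))) (ℕ.≤-reflexive (≡.sym at-i)))
  μ : 𝒴 _
  μ = record { part = f ; decreasing = f-decreasing }

-- Dual to `lowered`: only a comparison of row i with a row above it can be spoiled, and `corner`
-- leaves room there.
raised : ∀ {n} (μ : 𝒴 n) i → (∀ j → j Fin.< i → part μ i ℕ.< part μ j) → ∃₂ λ j ν → μ ⋖[ i , j ] ν
raised μ i corner = part μ i , ν , parts⇒⋖ {μ = μ} {ν} ≡.refl at-i λ k k≢i → ≡.sym (off-i k k≢i)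
  where
  f = updateAt (part μ) i suc
  at-i : f i ≡ suc (part μ i)
  at-i = updateAt-updates i (part μ)
  off-i : ∀ k → k ≢ i → f k ≡ part μ k
  off-i k = updateAt-minimal k i (part μ)
  μ≤f : ∀ k → part μ k ≤ f k
  μ≤f k with k Fin.≟ i
  ... | yes ≡.refl = ℕ.≤-trans (ℕ.n≤1+n _) (ℕ.≤-reflexive (≡.sym at-i))
  ... | no k≢i     = ℕ.≤-reflexive (≡.sym (off-i k k≢i))
  f-decreasing : ∀ k l → k Fin.≤ l → f l ≤ f k
  f-decreasing k l k≤l with l Fin.≟ i
  ... | no l≢i = ℕ.≤-trans (ℕ.≤-reflexive (off-i l l≢i)) (ℕ.≤-trans (decreasing μ k l k≤l) (μ≤f k))
  ... | yes ≡.refl with k Fin.≟ l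
  ...   | yes ≡.refl = ℕ.≤-refl
  ...   | no k≢l     = ℕ.≤-trans (ℕ.≤-reflexive at-i) (ℕ.≤-trans (corner k (Fin.≤∧≢⇒< k≤l k≢l)) (μ≤f k))
  ν : 𝒴 _
  ν = record { part = f ; decreasing = f-decreasing }

-- A strict descent after row k would make that row nonempty and longer than every row below it, so
-- `lowered` would apply.
unremovable : ∀ {m} (ν : 𝒴 (suc m)) k → ¬ (∃₂ λ j μ → μ ⋖[ inject₁ k , j ] ν) → part ν (inject₁ k) ≡ part ν (suc k)
unremovable ν k ¬removable with part ν (inject₁ k) ℕ.≤? part ν (suc k)
... | yes νk≤νk+1 = ℕ.≤-antisym νk≤νk+1 (decreasing ν _ _ (ℕ.≤-trans (ℕ.≤-reflexive (Fin.toℕ-inject₁ k)) (ℕ.n≤1+n _)))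
... | no νk≰νk+1  = contradiction
  (lowered ν (inject₁ k) (ℕ.≤-<-trans z≤n (ℕ.≰⇒> νk≰νk+1))
    λ l k<l → ℕ.≤-<-trans (decreasing ν (suc k) l (≡.subst (ℕ._< toℕ l) (Fin.toℕ-inject₁ k) k<l)) (ℕ.≰⇒> νk≰νk+1))
  ¬removable

-- No row lies below the last one, so only emptiness can prevent a removal.
unremovable-last : ∀ {m} (ν : 𝒴 (suc m)) → ¬ (∃₂ λ j μ → μ ⋖[ fromℕ m , j ] ν) → part ν (fromℕ m) ≡ 0
unremovable-last {m} ν ¬removable = ℕ.n≤0⇒n≡0 (ℕ.≮⇒≥ λ 0<ν → ¬removable (lowered ν (fromℕ m) 0<ν
  λ l last<l → contradiction last<l (ℕ.≤⇒≯ (Fin.≤fromℕ l))))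

-- Were row k strictly longer than row `suc k`, so would be all rows above it, and `raised` would
-- apply.
unaddable : ∀ {m} (μ : 𝒴 (suc m)) k → ¬ (∃₂ λ j ν → μ ⋖[ suc k , j ] ν) → part μ (inject₁ k) ≡ part μ (suc k)
unaddable μ k ¬addable with part μ (inject₁ k) ℕ.≤? part μ (suc k)
... | yes μk≤μk+1 = ℕ.≤-antisym μk≤μk+1 (decreasing μ _ _ (ℕ.≤-trans (ℕ.≤-reflexive (Fin.toℕ-inject₁ k)) (ℕ.n≤1+n _)))
... | no μk≰μk+1  = contradiction
  (raised μ (suc k) λ l l<k+1 → ℕ.<-≤-trans (ℕ.≰⇒> μk≰μk+1)
    (decreasing μ l (inject₁ k) (ℕ.≤-trans (ℕ.s≤s⁻¹ l<k+1) (ℕ.≤-reflexive (≡.sym (Fin.toℕ-inject₁ k))))))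
  ¬addable

zero-addable : ∀ {m} (μ : 𝒴 (suc m)) → ∃₂ λ j ν → μ ⋖[ zero , j ] ν
zero-addable μ = raised μ zero λ _ ()

-- Contents and term-by-term comparison.

module _ {n} (i : Fin n) where
  open +-*-Solver
  private
    d = δ i
    n≡1+i+d : n ≡ suc (toℕ i ℕ.+ d)
    n≡1+i+d = ≡.sym (ℕ.m+[n∸m]≡n (Fin.toℕ<n i))

  -- With `suc j` the length of row i, the right side is the shifted exponent that differentiation
  -- brings down.
  removed-content : ∀ j → + n ℤ.+ content (i , j) ≡ + (suc j ℕ.+ d)
  removed-content j = ≡.trans (≡.cong (λ m → + m ℤ.+ content (i , j)) n≡1+i+d)
    (solve 3 (λ i j d → (con (+ 1) :+ (i :+ d)) :+ (j :- i) := (con (+ 1) :+ j) :+ d) ≡.refl (+ toℕ i) (+ j) (+ d))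

  -- With `j` the length of row i, the shifted exponent exceeds the content by n - 1 in every row;
  -- this common excess is what the staircase correction cancels.
  added-content : ∀ j → + (j ℕ.+ d) ≡ content (i , j) ℤ.+ + (n ∸ 1)
  added-content j = ≡.trans
    (solve 3 (λ i j d → j :+ d := (j :- i) :+ (i :+ d)) ≡.refl (+ toℕ i) (+ j) (+ d))
    (≡.cong (λ m → content (i , j) ℤ.+ + (m ∸ 1)) (≡.sym n≡1+i+d))

updateAt-+δ : ∀ {n} (μ ν : 𝒴 n) i (g : ℕ → ℕ) → g (part ν i ℕ.+ δ i) ≡ part μ i ℕ.+ δ i →
              (∀ k → k ≢ i → part μ k ≡ part ν k) → updateAt (ν +δ) i g ≗ μ +δ
updateAt-+δ μ ν i g at-i off-i k with k Fin.≟ i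
... | yes ≡.refl = ≡.trans (updateAt-updates i (ν +δ)) at-i
... | no k≢i     = ≡.trans (updateAt-minimal k i (ν +δ) k≢i) (≡.cong (ℕ._+ δ k) (≡.sym (off-i k k≢i)))

-- In the last row the part and the staircase are both zero, so the coefficient vanishes although
-- the alternant need not; in any other row lowering the exponent makes two neighbouring columns
-- equal.
unremovable-vanishes : ∀ {n} (i : Fin n) (ν : 𝒴 n) → ¬ (∃₂ λ j μ → μ ⋖[ i , j ] ν) →
  ι ((ν +δ) i) ⊗ a (updateAt (ν +δ) i ℕ.pred) ≋ con ℚ.0ℚ
unremovable-vanishes {suc m} i ν ¬removable with view i
... | ‵fromℕ     rewrite unremovable-last ν ¬removable | δ-last m = ⊗-zeroˡ _
... | ‵inject₁ k = trans
  (*-congˡ (alternant-lower-adjacent var (ν +δ) k (+δ-step ν k (unremovable ν k ¬removable)))) (zeroʳ _)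
  where
  open CommutativeRing (polynomialRing (suc m)) using (trans; *-congˡ; zeroʳ)
  open ColumnReplacement (polynomialRing (suc m)) using (alternant-lower-adjacent)

-- The first row always takes a cell; in any other row the raised exponent collides with the one
-- before it.
unaddable-vanishes : ∀ {n} (i : Fin n) (ν : 𝒴 n) → ¬ (∃₂ λ j μ → ν ⋖[ i , j ] μ) →
  a (updateAt (ν +δ) i suc) ≋ con ℚ.0ℚ
unaddable-vanishes zero    ν ¬addable = contradiction (zero-addable ν) ¬addable
unaddable-vanishes (suc k) ν ¬addable = alternant-raise-adjacent var (ν +δ) k (+δ-step ν k (unaddable ν k ¬addable))
  where open ColumnReplacement (polynomialRing _) using (alternant-raise-adjacent)

module _ {n : ℕ} (ν : 𝒴 n) where
  open CommutativeRing (polynomialRing n) hiding (zero)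
  open ColumnReplacement (polynomialRing n) using (alternant-cong)
  open import Relation.Binary.Reasoning.Setoid setoid

  -- The decision `r` is a variable, so that matching on it reduces `rowTerm`. A removable cell
  -- turns the alternant into `schurPolynomial μ * a δ`; otherwise both sides vanish.
  removal-term : ∀ i (r : Dec (∃₂ λ j μ → μ ⋖[ i , j ] ν)) →
    ι ((ν +δ) i) * a (updateAt (ν +δ) i ℕ.pred) ≈
    polynomial (rowTerm ν (λ □ μ → fromℤ (+ n ℤ.+ content □) · schur μ) i r) * a δ
  removal-term i (yes (j , μ , μ⋖ν)) = let μi≡j , νi≡1+j , μ≡ν = ⋖⇒parts {μ = μ} {ν} μ⋖ν in begin
    ι ((ν +δ) i) * a (updateAt (ν +δ) i ℕ.pred)
      ≈⟨ *-cong (reflexive (≡.cong (con ∘ fromℤ) (≡.trans (≡.cong (λ m → + (m ℕ.+ δ i)) νi≡1+j) (≡.sym (removed-content i j)))))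
           (alternant-cong var (updateAt-+δ μ ν i ℕ.pred
             (≡.trans (≡.cong (λ m → ℕ.pred (m ℕ.+ δ i)) νi≡1+j) (≡.cong (ℕ._+ δ i) (≡.sym μi≡j))) μ≡ν)) ⟩
    con (fromℤ (+ n ℤ.+ content (i , j))) * a (μ +δ)
      ≈⟨ *-congˡ (schurPolynomial-quotient μ) ⟨
    con (fromℤ (+ n ℤ.+ content (i , j))) * (schurPolynomial μ * a δ)
      ≈⟨ *-assoc _ _ _ ⟨
    con (fromℤ (+ n ℤ.+ content (i , j))) * schurPolynomial μ * a δ ∎
  removal-term i (no ¬removable) = trans (unremovable-vanishes i ν ¬removable) (sym (zeroˡ _))

  -- The column `part ν i` yields a coefficient even where no cell can be added; where one can, it
  -- is the column of that cell.
  addition-term : ∀ i (r : Dec (∃₂ λ j μ → ν ⋖[ i , j ] μ)) →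
    con (fromℤ (content (i , part ν i))) * a (updateAt (ν +δ) i suc) ≈
    polynomial (rowTerm ν (λ □ μ → fromℤ (content □) · schur μ) i r) * a δ
  addition-term i (yes (j , μ , ν⋖μ)) = let νi≡j , μi≡1+j , ν≡μ = ⋖⇒parts {μ = ν} {μ} ν⋖μ in begin
    con (fromℤ (content (i , part ν i))) * a (updateAt (ν +δ) i suc)
      ≈⟨ *-cong (reflexive (≡.cong (λ l → con (fromℤ (content (i , l)))) νi≡j))
           (alternant-cong var (updateAt-+δ μ ν i suc
             (≡.cong (ℕ._+ δ i) (≡.trans (≡.cong suc νi≡j) (≡.sym μi≡1+j))) λ k k≢i → ≡.sym (ν≡μ k k≢i))) ⟩
    con (fromℤ (content (i , j))) * a (μ +δ)
      ≈⟨ *-congˡ (schurPolynomial-quotient μ) ⟨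
    con (fromℤ (content (i , j))) * (schurPolynomial μ * a δ)
      ≈⟨ *-assoc _ _ _ ⟨
    con (fromℤ (content (i , j))) * schurPolynomial μ * a δ ∎
  addition-term i (no ¬addable) = trans (*-congˡ (unaddable-vanishes i ν ¬addable)) (trans (zeroʳ _) (sym (zeroˡ _)))

-- Term by term, the invariance of the Vandermonde determinant under a common translation of the
-- variables: the last exponent is zero, and every other one collides when lowered.
lowered-δ : ∀ {n} (i : Fin n) → ι (δ i) ⊗ a (updateAt δ i ℕ.pred) ≋ con ℚ.0ℚ
lowered-δ {suc m} i with view i
... | ‵fromℕ     rewrite δ-last m = ⊗-zeroˡ _
... | ‵inject₁ k = trans (*-congˡ (alternant-lower-adjacent var δ k (δ-step k))) (zeroʳ _)
  where
  open CommutativeRing (polynomialRing (suc m)) using (trans; *-congˡ; zeroʳ)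
  open ColumnReplacement (polynomialRing (suc m)) using (alternant-lower-adjacent)

-- Beyond the first column the alternants vanish, and in the first column `δ` is n - 1. Making the
-- coefficient constant lets `pieri` sum the terms.
raised-δ : ∀ {n} (i : Fin n) → ι (δ i) ⊗ a (updateAt δ i suc) ≋ ι (n ∸ 1) ⊗ a (updateAt δ i suc)
raised-δ         zero    = ≋-refl
raised-δ {suc m} (suc k) = trans (*-congˡ vanishing) (trans (zeroʳ _) (sym (trans (*-congˡ vanishing) (zeroʳ _))))
  where
  open CommutativeRing (polynomialRing (suc m)) hiding (zero)
  open ColumnReplacement (polynomialRing (suc m))
  vanishing : a (updateAt δ (suc k) suc) ≈ 0#
  vanishing = alternant-raise-adjacent var δ k (δ-step k)

polynomial-sum : ∀ {n m} (f : Fin m → Λ n) →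
  polynomial (MonoidSum.sum (CommutativeRing.+-commutativeMonoid (symmetricRing n)) f) ≡
  MonoidSum.sum (CommutativeRing.+-commutativeMonoid (polynomialRing n)) (polynomial ∘ f)
polynomial-sum {m = zero}  f = ≡.refl
polynomial-sum {m = suc m} f = ≡.cong (polynomial (f zero) ⊕_) (polynomial-sum (f ∘ suc))

-- The three operators on Schur polynomials.

module _ {n : ℕ} (ν : 𝒴 n) where
  open CommutativeRing (polynomialRing n) hiding (zero; distribʳ)
  open RingProperties ring using (x[y-z]≈xy-xz; x∙y⁻¹≈ε⇒x≈y; x≈y⇒x∙y⁻¹≈ε; +-cancelʳ)
  open MonoidSum +-commutativeMonoid using (sum; sum-cong-≋; ∑-distrib-+; sum-replicate-zero; sum-syntax)
  open SemiringSum semiring using (*-distribˡ-sum; *-distribʳ-sum)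
  open Exp semiring using (_^_)
  open ColumnReplacement (polynomialRing n)
  open Solver commutativeSemiring using (solve; _:+_; _:*_; _:=_) renaming (con to κ)
  open import Relation.Binary.Reasoning.Setoid setoid

  a-δ-cancelʳ : ∀ p q → p * a δ ≈ q * a δ → p ≈ q
  a-δ-cancelʳ p q eq = x∙y⁻¹≈ε⇒x≈y p q (a-δ-cancel (p - q) (begin
    a δ * (p - q)        ≈⟨ x[y-z]≈xy-xz (a δ) p q ⟩
    a δ * p - a δ * q    ≈⟨ x≈y⇒x∙y⁻¹≈ε (trans (*-comm _ _) (trans eq (*-comm _ _))) ⟩
    0#                   ∎))

  s : Poly n
  s = schurPolynomial ν

  A : (ℕ → ℕ) → Fin n → Poly n
  A g c = a (updateAt (ν +δ) c g)

  -- The quotient rule without division: the Leibniz rule for `s * a δ ≈ a (ν +δ)`, with both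
  -- alternants differentiated column by column.
  schur-quotient-rule : ∀ (v : Fin n → Poly n) (g : ℕ → ℕ) → (∀ i m → v i * var i ^ m ≈ var i ^ g (suc m)) →
    vectorField v s * a δ + s * sum (λ c → ι (δ c) * a (updateAt δ c g)) ≈ sum λ c → ι ((ν +δ) c) * A g c
  schur-quotient-rule v g v-power = begin
    vectorField v s * a δ + s * sum (λ c → ι (δ c) * a (updateAt δ c g))
      ≈⟨ +-congˡ (*-congˡ (vectorField-alternant v g v-power δ)) ⟨
    vectorField v s * a δ + s * vectorField v (a δ)   ≈⟨ leibniz s (a δ) ⟨
    vectorField v (s * a δ)                           ≈⟨ cong (schurPolynomial-quotient ν) ⟩
    vectorField v (a (ν +δ))                          ≈⟨ vectorField-alternant v g v-power (ν +δ) ⟩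
    sum (λ c → ι ((ν +δ) c) * A g c)                  ∎
    where open IsDerivation (vectorField-isDerivation v)

  -- Euler's identity for the homogeneous polynomial `a μ`: the exponents stay fixed, and the
  -- coefficients add up to its degree.
  sum-fixed : ∀ (μ : Fin n → ℕ) → sum (λ c → ι (μ c) * a (updateAt μ c λ m → m)) ≈ ι (NatSum.sum μ) * a μ
  sum-fixed μ = begin
    sum (λ c → ι (μ c) * a (updateAt μ c λ m → m))  ≈⟨ sum-cong-≋ (λ c → *-congˡ (alternant-cong var (updateAt-id c μ))) ⟩
    sum (λ c → ι (μ c) * a μ)                       ≈⟨ *-distribʳ-sum (a μ) (ι ∘ μ) ⟨
    sum (ι ∘ μ) * a μ                               ≈⟨ *-congʳ (ι-sum μ) ⟨
    ι (NatSum.sum μ) * a μ                          ∎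

  ∂-schur : ∑[ i < n ] ∂ i s ≈ polynomial (∑-remove ν λ □ μ → fromℤ (+ n ℤ.+ content □) · schur μ)
  ∂-schur = a-δ-cancelʳ _ _ (begin
    sum (λ i → ∂ i s) * a δ
      ≈⟨ *-congʳ (sum-cong-≋ λ i → *-identityˡ (∂ i s)) ⟨
    vectorField (const 1#) s * a δ
      -- The derivative of the denominator is zero by `lowered-δ`; it is inserted to match the
      -- quotient rule.
      ≈⟨ trans (+-congˡ (trans (*-congˡ (trans (sum-cong-≋ lowered-δ) (sum-replicate-zero n))) (zeroʳ s))) (+-identityʳ _) ⟨
    vectorField (const 1#) s * a δ + s * sum (λ c → ι (δ c) * a (updateAt δ c ℕ.pred))
      ≈⟨ schur-quotient-rule (const 1#) ℕ.pred (λ i m → *-identityˡ _) ⟩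
    sum (λ c → ι ((ν +δ) c) * A ℕ.pred c)
      ≈⟨ sum-cong-≋ (λ c → removal-term ν c (removable? ν c)) ⟩
    sum (λ c → polynomial (row c) * a δ)
      ≈⟨ *-distribʳ-sum (a δ) (polynomial ∘ row) ⟨
    sum (polynomial ∘ row) * a δ
      ≈⟨ *-congʳ (reflexive (polynomial-sum row)) ⟨
    polynomial (∑-remove ν _) * a δ ∎)
    where
    row : Fin n → Λ n
    row c = rowTerm ν (λ □ μ → fromℤ (+ n ℤ.+ content □) · schur μ) c (removable? ν c)

  -- The degree of `a (ν +δ)` exceeds that of `a δ` by `∣ ν ∣`. The staircase contribution is added
  -- to both sides and cancelled, which avoids subtraction.
  euler-schur : vectorField var s ≈ ι ∣ ν ∣ * s
  euler-schur = a-δ-cancelʳ _ _ (+-cancelʳ (s * (ι ∣δ∣ * a δ)) _ _ (begin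
    vectorField var s * a δ + s * (ι ∣δ∣ * a δ)
      ≈⟨ +-congˡ (*-congˡ (sum-fixed δ)) ⟨
    vectorField var s * a δ + s * sum (λ c → ι (δ c) * a (updateAt δ c λ m → m))
      ≈⟨ schur-quotient-rule var (λ m → m) (λ i m → refl) ⟩
    sum (λ c → ι ((ν +δ) c) * A (λ m → m) c)
      ≈⟨ sum-fixed (ν +δ) ⟩
    ι (NatSum.sum (ν +δ)) * a (ν +δ)
      ≈⟨ *-cong (trans (reflexive (≡.cong ι (NatSum.∑-distrib-+ (part ν) δ))) (con-fromℤ-+ (+ ∣ ν ∣) (+ ∣δ∣)))
                (sym (schurPolynomial-quotient ν)) ⟩
    (ι ∣ ν ∣ + ι ∣δ∣) * (s * a δ)
      ≈⟨ solve 4 (λ x y s a → (x :+ y) :* (s :* a) := x :* s :* a :+ s :* (y :* a)) refl (ι ∣ ν ∣) (ι ∣δ∣) s (a δ) ⟩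
    ι ∣ ν ∣ * s * a δ + s * (ι ∣δ∣ * a δ) ∎))
    where
    ∣δ∣ : ℕ
    ∣δ∣ = NatSum.sum (δ {n})

  d₀-schur : d₀ s ≈ ι (2 ℕ.* ∣ ν ∣) * s
  d₀-schur = begin
    ι 2 * vectorField var s      ≈⟨ *-congˡ euler-schur ⟩
    ι 2 * (ι ∣ ν ∣ * s)          ≈⟨ *-assoc _ _ _ ⟨
    ι 2 * ι ∣ ν ∣ * s            ≈⟨ *-congʳ (con-fromℤ-* (+ 2) (+ ∣ ν ∣)) ⟨
    con (fromℤ (+ 2 ℤ.* + ∣ ν ∣)) * s  ≈⟨ *-congʳ (reflexive (≡.cong (con ∘ fromℤ) (ℤ.pos-* 2 ∣ ν ∣))) ⟨
    ι (2 ℕ.* ∣ ν ∣) * s          ∎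

  -- Pieri's rule is used twice: backwards to gather the sum into a multiple of `sum var * a δ`, and
  -- forwards once `s` has turned `a δ` into `a (ν +δ)`.
  δ-shift : s * sum (λ c → ι (δ c) * a (updateAt δ c suc)) ≈ sum λ c → ι (n ∸ 1) * A suc c
  δ-shift = begin
    s * sum (λ c → ι (δ c) * a (updateAt δ c suc))        ≈⟨ *-congˡ (sum-cong-≋ raised-δ) ⟩
    s * sum (λ c → ι (n ∸ 1) * a (updateAt δ c suc))      ≈⟨ *-congˡ (*-distribˡ-sum (ι (n ∸ 1)) (λ c → a (updateAt δ c suc))) ⟨
    s * (ι (n ∸ 1) * sum (λ c → a (updateAt δ c suc)))    ≈⟨ *-congˡ (*-congˡ (pieri var δ)) ⟨
    s * (ι (n ∸ 1) * (sum var * a δ))                     ≈⟨ solve 4 (λ s k e a → s :* (k :* (e :* a)) := k :* (e :* (s :* a))) refl s (ι (n ∸ 1)) (sum var) (a δ) ⟩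
    ι (n ∸ 1) * (sum var * (s * a δ))                     ≈⟨ *-congˡ (*-congˡ (schurPolynomial-quotient ν)) ⟩
    ι (n ∸ 1) * (sum var * a (ν +δ))                      ≈⟨ *-congˡ (pieri var (ν +δ)) ⟩
    ι (n ∸ 1) * sum (A suc)                               ≈⟨ *-distribˡ-sum (ι (n ∸ 1)) (A suc) ⟩
    sum (λ c → ι (n ∸ 1) * A suc c)                       ∎

  -- The correction from `δ-shift` is added to both sides. Each coefficient splits by
  -- `added-content` into a content and n - 1, and the n - 1 terms form exactly this correction,
  -- which cancels.
  d₊-schur : d₊ s ≈ polynomial (∑-add ν λ □ μ → fromℤ (content □) · schur μ)
  d₊-schur = a-δ-cancelʳ _ _ (+-cancelʳ (sum λ c → ι (n ∸ 1) * A suc c) _ _ (begin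
    d₊ s * a δ + sum (λ c → ι (n ∸ 1) * A suc c)
      ≈⟨ +-congˡ δ-shift ⟨
    d₊ s * a δ + s * sum (λ c → ι (δ c) * a (updateAt δ c suc))
      ≈⟨ schur-quotient-rule (λ i → var i ^ 2) suc (λ i m → solve 2 (λ x y → x :* (x :* κ 1) :* y := x :* (x :* y)) refl (var i) (var i ^ m)) ⟩
    sum (λ c → ι ((ν +δ) c) * A suc c)
      ≈⟨ sum-cong-≋ (λ c → trans
           (*-congʳ (trans (reflexive (≡.cong (con ∘ fromℤ) (added-content c (part ν c)))) (con-fromℤ-+ (content (c , part ν c)) (+ (n ∸ 1)))))
           (distribʳ (A suc c) _ _)) ⟩
    sum (λ c → con (fromℤ (content (c , part ν c))) * A suc c + ι (n ∸ 1) * A suc c)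
      ≈⟨ ∑-distrib-+ (λ c → con (fromℤ (content (c , part ν c))) * A suc c) (λ c → ι (n ∸ 1) * A suc c) ⟩
    sum (λ c → con (fromℤ (content (c , part ν c))) * A suc c) + sum (λ c → ι (n ∸ 1) * A suc c)
      ≈⟨ +-congʳ (begin
           sum (λ c → con (fromℤ (content (c , part ν c))) * A suc c)  ≈⟨ sum-cong-≋ (λ c → addition-term ν c (addable? ν c)) ⟩
           sum (λ c → polynomial (row c) * a δ)                        ≈⟨ *-distribʳ-sum (a δ) (polynomial ∘ row) ⟨
           sum (polynomial ∘ row) * a δ                                ≈⟨ *-congʳ (reflexive (polynomial-sum row)) ⟨
           polynomial (∑-add ν _) * a δ                                ∎) ⟩
    polynomial (∑-add ν _) * a δ + sum (λ c → ι (n ∸ 1) * A suc c) ∎))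
    where
    row : Fin n → Λ n
    row c = rowTerm ν (λ □ μ → fromℤ (content □) · schur μ) c (addable? ν c)

theorem3 : ∀ n → 1 ≤ n → (ν : 𝒴 n) →
    let open CommutativeRing (symmetricRing n) in
    (D₋ (schur ν) ≈ - ∑-remove ν (λ □ μ → fromℤ (+ n ℤ.+ content □) · schur μ))
    × (D₀ (schur ν) ≈ fromℤ (+ (2 ℕ.* ∣ ν ∣)) · schur ν)
    × (D₊ (schur ν) ≈ ∑-add ν (λ □ μ → fromℤ (content □) · schur μ))
theorem3 n _ ν = CommutativeRing.-‿cong (polynomialRing n) (∂-schur ν) , d₀-schur ν , d₊-schur ν
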